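{- Let $(X,d)$ be a compact metric space, let $(x_i)_{i\ge1}$ and $(x'_i)_{i\ge1}$ be sequences in $X$, and let $(p_i)_{i\ge0}$ be a fast growing sequence. Let $z=z((p_i),(x_i))$ and $z'=z((p_i),(x'_i))$ be the associated Oxtoby sequences (with the same $(p_i)$). Suppose both $L((x_i))$ and $L((x'_i))$ have at least two points. Then for any isomorphism $f$ from $(\overline O(z),S)$ to $(\overline O(z'),S)$ we have $f(z)=S^m z'$ for some $m\in\mathbb Z$.
   Context: $S$ is the left shift on $X^{\mathbb Z}$, $S(x)(n)=x(n+1)$, and $\overline O(z)$ is the closure of $\{S^nz:n\in\mathbb Z\}$ in $X^{\mathbb Z}$. An isomorphism of systems $(A,S)\to(B,S)$ is a homeomorphism $h:A\to B$ with $h\circ S=S\circ h$. $L((x_i))$ denotes the $\omega$-limit set: the set of limits of convergent subsequences $(x_{n_k})$, $(n_k)$ strictly increasing. A sequence of natural numbers $(p_i)_{i\ge0}$ is fast growing if $p_0=1$, $p_i\mid p_{i+1}$ and $p_{i+1}/p_i\ge 3$ for all $i\ge0$. Given a fast growing sequence $(p_i)$ and a sequence $(x_i)_{i\ge1}$ in $X$, the Oxtoby sequence $z=z((p_i),(x_i))\in X^{\mathbb Z}$ is defined inductively: in step $1$ set $z(n)=x_1$ for all $n\equiv-1$ or $0\pmod{p_1}$. For $i\ge1$ and $k\in\mathbb Z$ let $J(i,k)$ be the set of $n\in[kp_i,(k+1)p_i)$ for which $z(n)$ is not yet defined at the end of step $i$; in step $i+1$ set $z(n)=x_{i+1}$ for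 all $n\in J(i,k)$ with $k\equiv-1$ or $0\pmod{p_{i+1}/p_i}$. This defines $z(n)$ for all $n\in\mathbb Z$. -}

module Defs where

open import Data.Integer.Base as ℤ using (ℤ; +_; -[1+_]; 0ℤ; 1ℤ; -1ℤ; ∣_∣; _/ℕ_)
import Data.Integer.Divisibility as ℤ
import Data.Integer.Properties as ℤ
open import Data.List.Base using (List)
open import Data.List.Relation.Unary.Any using (Any)
open import Data.Maybe.Base using (Maybe; just; nothing)
open import Data.Maybe using (Is-just; to-witness)
open import Data.Maybe.Relation.Unary.Any using (just)
open import Data.Nat.Base as ℕ using (ℕ; zero; suc; _≤_; _<_; z≤n; s≤s; NonZero; >-nonZero)
open import Data.Nat.Divisibility as ℕ using (quotient; _∣?_)
open import Data.Nat.DivMod using (m<n⇒m/n≡0; m<n⇒m%n≡m)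
import Data.Nat.Properties as ℕ
open import Data.Product.Base using (Σ; ∃; ∃-syntax; Σ-syntax; _×_; _,_; proj₁; proj₂)
open import Data.Rational.Base as ℚ using (ℚ; 0ℚ; ½)
import Data.Rational.Properties as ℚ
open import Data.Sum.Base using (_⊎_; inj₁; inj₂)
open import Data.Unit.Base using (tt)
open import Function.Base using (_∘_)
open import Function.Bundles using (Inverse)
open import Function.Metric.Structures using (IsGeneralMetric)
open import Level using (Level; 0ℓ) renaming (suc to lsuc)
open import Relation.Binary.Bundles using (Setoid)
open import Relation.Binary.Core using (Rel)
open import Relation.Binary.Definitions using (Monotonic₁)
open import Relation.Binary.PropositionalEquality using (_≡_; refl; sym; trans; cong; cong₂; subst; subst₂)
open import Relation.Binary.Structures using (IsEquivalence)
open import Relation.Nullary using (¬_; Dec; yes; no)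
open import Relation.Nullary.Decidable using (_⊎-dec_)
open import Relation.Nullary.Negation using (contradiction)
open import Relation.Unary using (Pred)

------------------------------------------------------------------------
-- Real numbers as Cauchy sequences of rationals

record ℝ : Set where
  field
    seq    : ℕ → ℚ
    cauchy : ∀ ε → 0ℚ ℚ.< ε →
             ∃[ N ] (∀ m n → N ≤ m → N ≤ n → ℚ.∣ seq m ℚ.- seq n ∣ ℚ.< ε)

open ℝ public

infix 4 _≈ᵣ_ _≤ᵣ_ _<ᵣ_
infixl 6 _+ᵣ_

_≈ᵣ_ : Rel ℝ 0ℓ
x ≈ᵣ y = ∀ ε → 0ℚ ℚ.< ε →
         ∃[ N ] (∀ n → N ≤ n → ℚ.∣ seq x n ℚ.- seq y n ∣ ℚ.< ε)

_≤ᵣ_ : Rel ℝ 0ℓ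
x ≤ᵣ y = ∀ ε → 0ℚ ℚ.< ε → ∃[ N ] (∀ n → N ≤ n → seq x n ℚ.≤ seq y n ℚ.+ ε)

_<ᵣ_ : Rel ℝ 0ℓ
x <ᵣ y = ∃[ ε ] (0ℚ ℚ.< ε × ∃[ N ] (∀ n → N ≤ n → seq x n ℚ.+ ε ℚ.≤ seq y n))

fromℚ : ℚ → ℝ
fromℚ q = record
  { seq    = λ _ → q
  ; cauchy = λ ε 0<ε → 0 , λ _ _ _ _ → subst (ℚ._< ε) (sym (cong ℚ.∣_∣ (ℚ.+-inverseʳ q))) 0<ε
  }

0ᵣ : ℝ
0ᵣ = fromℚ 0ℚ

half : ℚ → ℚ
half ε = ½ ℚ.* ε

0<half : ∀ {ε} → 0ℚ ℚ.< ε → 0ℚ ℚ.< half ε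
0<half {ε} 0<ε = subst (ℚ._< half ε) (ℚ.*-zeroʳ ½) (ℚ.*-monoʳ-<-pos ½ 0<ε)

half+half : ∀ ε → half ε ℚ.+ half ε ≡ ε
half+half ε = trans (sym (ℚ.*-distribʳ-+ ε ½ ½)) (ℚ.*-identityˡ ε)

interchange : ∀ a b c e → (a ℚ.+ b) ℚ.- (c ℚ.+ e) ≡ (a ℚ.- c) ℚ.+ (b ℚ.- e)
interchange a b c e = begin
  (a ℚ.+ b) ℚ.- (c ℚ.+ e)           ≡⟨ cong ((a ℚ.+ b) ℚ.+_) (ℚ.neg-distrib-+ c e) ⟩
  (a ℚ.+ b) ℚ.+ (ℚ.- c ℚ.+ ℚ.- e)   ≡⟨ ℚ.+-assoc a b _ ⟩
  a ℚ.+ (b ℚ.+ (ℚ.- c ℚ.+ ℚ.- e))   ≡⟨ cong (a ℚ.+_) (ℚ.+-assoc b _ _) ⟨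
  a ℚ.+ ((b ℚ.+ ℚ.- c) ℚ.+ ℚ.- e)   ≡⟨ cong (λ t → a ℚ.+ (t ℚ.+ ℚ.- e)) (ℚ.+-comm b _) ⟩
  a ℚ.+ ((ℚ.- c ℚ.+ b) ℚ.+ ℚ.- e)   ≡⟨ cong (a ℚ.+_) (ℚ.+-assoc (ℚ.- c) b (ℚ.- e)) ⟩
  a ℚ.+ (ℚ.- c ℚ.+ (b ℚ.- e))       ≡⟨ ℚ.+-assoc a _ _ ⟨
  (a ℚ.- c) ℚ.+ (b ℚ.- e)           ∎
  where open Relation.Binary.PropositionalEquality.≡-Reasoning

_+ᵣ_ : ℝ → ℝ → ℝ
x +ᵣ y = record
  { seq    = λ n → seq x n ℚ.+ seq y n
  ; cauchy = λ ε 0<ε →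
      let (M , p) = cauchy x (half ε) (0<half 0<ε)
          (N , q) = cauchy y (half ε) (0<half 0<ε)
      in M ℕ.⊔ N , λ m n M⊔N≤m M⊔N≤n →
        subst₂ (λ s t → ℚ.∣ s ∣ ℚ.< t)
          (sym (interchange (seq x m) (seq y m) (seq x n) (seq y n)))
          (half+half ε)
          (ℚ.≤-<-trans (ℚ.∣p+q∣≤∣p∣+∣q∣ (seq x m ℚ.- seq x n) (seq y m ℚ.- seq y n))
            (ℚ.+-mono-<
              (p m n (ℕ.m⊔n≤o⇒m≤o M N M⊔N≤m) (ℕ.m⊔n≤o⇒m≤o M N M⊔N≤n))
              (q m n (ℕ.m⊔n≤o⇒n≤o M N M⊔N≤m) (ℕ.m⊔n≤o⇒n≤o M N M⊔N≤n))))
  }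

p≤∣p∣ : ∀ p → p ℚ.≤ ℚ.∣ p ∣
p≤∣p∣ p with ℚ.≤-total 0ℚ p
... | inj₁ 0≤p = ℚ.≤-reflexive (sym (ℚ.0≤p⇒∣p∣≡p 0≤p))
... | inj₂ p≤0 = ℚ.≤-trans p≤0 (ℚ.0≤∣p∣ p)

≈0⇒< : ∀ x ε → x ≈ᵣ 0ᵣ → 0ᵣ <ᵣ ε → x <ᵣ ε
≈0⇒< x ε x≈0 (δ , 0<δ , M , p) =
  let (N , q) = x≈0 (half δ) (0<half 0<δ)
      open ℚ.≤-Reasoning
  in half δ , 0<half 0<δ , M ℕ.⊔ N , λ n M⊔N≤n → begin
       seq x n ℚ.+ half δ             ≡⟨ cong (ℚ._+ half δ) (ℚ.+-identityʳ (seq x n)) ⟨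
       (seq x n ℚ.- 0ℚ) ℚ.+ half δ    ≤⟨ ℚ.+-monoˡ-≤ (half δ) (p≤∣p∣ (seq x n ℚ.- 0ℚ)) ⟩
       ℚ.∣ seq x n ℚ.- 0ℚ ∣ ℚ.+ half δ ≤⟨ ℚ.+-monoˡ-≤ (half δ) (ℚ.<⇒≤ (q n (ℕ.m⊔n≤o⇒n≤o M N M⊔N≤n))) ⟩
       half δ ℚ.+ half δ              ≡⟨ half+half δ ⟩
       δ                              ≡⟨ ℚ.+-identityˡ δ ⟨
       0ℚ ℚ.+ δ                       ≤⟨ p n (ℕ.m⊔n≤o⇒m≤o M N M⊔N≤n) ⟩
       seq ε n                        ∎

------------------------------------------------------------------------
-- Compact metric spaces

record MetricSpace (ℓ : Level) : Set (lsuc ℓ) where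
  infix 4 _≈_
  field
    Carrier  : Set ℓ
    _≈_      : Rel Carrier ℓ
    d        : Carrier → Carrier → ℝ
    isMetric : IsGeneralMetric _≈_ _≈ᵣ_ _≤ᵣ_ 0ᵣ _+ᵣ_ d

  open IsGeneralMetric isMetric public
    using (module EqC; ≈⇒0; 0⇒≈; triangle)

module _ {ℓ : Level} (X : MetricSpace ℓ) where
  open MetricSpace X

  IsOpen : Pred Carrier ℓ → Set ℓ
  IsOpen U = ∀ x → U x → ∃[ ε ] (0ᵣ <ᵣ ε × (∀ y → d x y <ᵣ ε → U y))

  Compact : Set (lsuc ℓ)
  Compact = ∀ {I : Set ℓ} (U : I → Pred Carrier ℓ) →
            (∀ i → IsOpen (U i)) →
            (∀ x → ∃[ i ] U i x) →
            Σ[ is ∈ List I ] (∀ x → Any (λ i → U i x) is)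

  Converges : (ℕ → Carrier) → Carrier → Set
  Converges s a = ∀ ε → 0ᵣ <ᵣ ε → ∃[ N ] (∀ n → N ≤ n → d (s n) a <ᵣ ε)

  ωLimit : (ℕ → Carrier) → Pred Carrier 0ℓ
  ωLimit s a = Σ[ φ ∈ (ℕ → ℕ) ] (Monotonic₁ _<_ _<_ φ × Converges (s ∘ φ) a)

  AtLeastTwoPoints : Pred Carrier 0ℓ → Set ℓ
  AtLeastTwoPoints A = ∃[ a ] ∃[ b ] (A a × A b × ¬ (a ≈ b))

------------------------------------------------------------------------
-- Shift dynamics on X^ℤ

S^[_] : ∀ {ℓ} {A : Set ℓ} → ℤ → (ℤ → A) → (ℤ → A)
S^[ n ] x i = x (i ℤ.+ n)

S : ∀ {ℓ} {A : Set ℓ} → (ℤ → A) → (ℤ → A)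
S = S^[ 1ℤ ]

module _ {ℓ : Level} (X : MetricSpace ℓ) where
  open MetricSpace X

  infix 4 _≋_

  _≋_ : Rel (ℤ → Carrier) ℓ
  x ≋ y = ∀ i → x i ≈ y i

  -- For fixed x, the sets { y ∣ Near N ε x y } with N : ℕ and ε > 0 form a
  -- neighbourhood base of x in the product topology on X^ℤ.
  Near : ℕ → ℝ → Rel (ℤ → Carrier) 0ℓ
  Near N ε x y = ∀ i → ∣ i ∣ ≤ N → d (x i) (y i) <ᵣ ε

  InOrbitClosure : (ℤ → Carrier) → Pred (ℤ → Carrier) 0ℓ
  InOrbitClosure z y = ∀ N ε → 0ᵣ <ᵣ ε → ∃[ n ] Near N ε y (S^[ n ] z)

  OrbitClosure : (ℤ → Carrier) → Set ℓ
  OrbitClosure z = Σ (ℤ → Carrier) (InOrbitClosure z)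

  orbitClosureSetoid : (ℤ → Carrier) → Setoid ℓ ℓ
  orbitClosureSetoid z = record
    { Carrier       = OrbitClosure z
    ; _≈_           = λ u v → proj₁ u ≋ proj₁ v
    ; isEquivalence = record
      { refl  = λ i → EqC.refl
      ; sym   = λ p i → EqC.sym (p i)
      ; trans = λ p q i → EqC.trans (p i) (q i)
      }
    }

  basePoint : (z : ℤ → Carrier) → OrbitClosure z
  basePoint z = z , λ N ε 0<ε → 0ℤ , λ i _ →
    subst (λ j → d (z i) (z j) <ᵣ ε) (sym (ℤ.+-identityʳ i))
      (≈0⇒< (d (z i) (z i)) ε (≈⇒0 EqC.refl) 0<ε)

  shift : (z : ℤ → Carrier) → OrbitClosure z → OrbitClosure z
  shift z (y , y∈) = S y , λ N ε 0<ε →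
    let (n , near) = y∈ (suc N) ε 0<ε
    in 1ℤ ℤ.+ n , λ i ∣i∣≤N →
      subst (λ j → d (y (i ℤ.+ 1ℤ)) (z j) <ᵣ ε) (ℤ.+-assoc i 1ℤ n)
        (near (i ℤ.+ 1ℤ) (ℕ.≤-trans (ℤ.∣i+j∣≤∣i∣+∣j∣ i 1ℤ)
          (subst (_≤ suc N) (ℕ.+-comm 1 ∣ i ∣) (s≤s ∣i∣≤N))))

  Continuous : ∀ {z z′} → (OrbitClosure z → OrbitClosure z′) → Set ℓ
  Continuous {z} f = ∀ u N ε → 0ᵣ <ᵣ ε →
    ∃[ M ] ∃[ δ ] (0ᵣ <ᵣ δ ×
      (∀ v → Near M δ (proj₁ u) (proj₁ v) → Near N ε (proj₁ (f u)) (proj₁ (f v))))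

  record Isomorphism (z z′ : ℤ → Carrier) : Set ℓ where
    field
      inverse : Inverse (orbitClosureSetoid z) (orbitClosureSetoid z′)

    open Inverse inverse public using (to; from)

    field
      to-continuous   : Continuous {z} {z′} to
      from-continuous : Continuous {z′} {z} from
      commutes        : ∀ u → proj₁ (to (shift z u)) ≋ proj₁ (shift z′ (to u))

------------------------------------------------------------------------
-- Oxtoby sequences

record FastGrowing (p : ℕ → ℕ) : Set where
  field
    p₀≡1    : p 0 ≡ 1
    divides : ∀ i → p i ℕ.∣ p (suc i)

  ratio : ℕ → ℕ
  ratio i = quotient (divides i)

  field
    3≤ratio : ∀ i → 3 ≤ ratio i

  i<pᵢ : ∀ i → i < p i
  i<pᵢ zero    = ℕ.≤-reflexive (sym p₀≡1)
  i<pᵢ (suc i) = begin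
    suc (suc i)       ≤⟨ s≤s (i<pᵢ i) ⟩
    suc (p i)         ≤⟨ ℕ.+-monoˡ-≤ (p i) (ℕ.≤-trans (s≤s z≤n) (i<pᵢ i)) ⟩
    p i ℕ.+ p i       ≡⟨ cong (p i ℕ.+_) (ℕ.+-identityʳ (p i)) ⟨
    2 ℕ.* p i         ≤⟨ ℕ.*-monoˡ-≤ (p i) (ℕ.≤-trans (ℕ.n≤1+n 2) (3≤ratio i)) ⟩
    ratio i ℕ.* p i   ≡⟨ ℕ._∣_.equality (divides i) ⟨
    p (suc i)         ∎
    where open ℕ.≤-Reasoning

  instance
    pᵢ≢0 : ∀ {i} → NonZero (p i)
    pᵢ≢0 {i} = >-nonZero (ℕ.≤-trans (s≤s z≤n) (i<pᵢ i))

infix 4 _≡_[mod_]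

_≡_[mod_] : ℤ → ℤ → ℕ → Set
a ≡ b [mod q ] = + q ℤ.∣ (a ℤ.- b)

≡mod? : ∀ a b q → Dec (a ≡ b [mod q ])
≡mod? a b q = q ∣? ∣ a ℤ.- b ∣

module _ {p : ℕ → ℕ} (fg : FastGrowing p) where
  open FastGrowing fg

  -- The k with n ∈ [k pᵢ , (k + 1) pᵢ); _/ℕ_ rounds towards -∞.
  block : ℕ → ℤ → ℤ
  block i n = n /ℕ p i

  Selected : ℕ → ℤ → Set
  Selected i n = block i n ≡ -1ℤ [mod ratio i ] ⊎ block i n ≡ 0ℤ [mod ratio i ]

  selected? : ∀ i n → Dec (Selected i n)
  selected? i n = ≡mod? (block i n) -1ℤ (ratio i) ⊎-dec ≡mod? (block i n) 0ℤ (ratio i)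

  -- stage x i n is the value of z(n) at the end of step i, if already defined.
  -- The sequence (xᵢ)_{i≥1} is indexed from 0, so step i + 1 uses x i.  Since
  -- p₀ = 1, step 1 is the general step with J(0,k) = {k}.
  stage : ∀ {ℓ} {A : Set ℓ} → (ℕ → A) → ℕ → ℤ → Maybe A
  stage x zero    n = nothing
  stage x (suc i) n with stage x i n
  ... | just v  = just v
  ... | nothing with selected? i n
  ...   | yes _ = just (x i)
  ...   | no  _ = nothing

  nearZero : ∀ n → (block ∣ n ∣ n ≡ -1ℤ) ⊎ (block ∣ n ∣ n ≡ 0ℤ)
  nearZero (+ m) = inj₂ (cong +_ (m<n⇒m/n≡0 (i<pᵢ m)))
  nearZero -[1+ m ]
    with suc m ℕ.% p (suc m) | m<n⇒m%n≡m (i<pᵢ (suc m))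
  ... | .(suc m) | refl = inj₁ (cong -[1+_] (m<n⇒m/n≡0 (i<pᵢ (suc m))))

  selectedNearZero : ∀ n → Selected ∣ n ∣ n
  selectedNearZero n with nearZero n
  ... | inj₁ eq = inj₁ (subst (λ k → k ≡ -1ℤ [mod ratio ∣ n ∣ ]) (sym eq) (_ ℕ.∣0))
  ... | inj₂ eq = inj₂ (subst (λ k → k ≡ 0ℤ [mod ratio ∣ n ∣ ]) (sym eq) (_ ℕ.∣0))

  selected⇒defined : ∀ {ℓ} {A : Set ℓ} (x : ℕ → A) i n →
                     Selected i n → Is-just (stage x (suc i) n)
  selected⇒defined x i n sel with stage x i n
  ... | just v  = just tt
  ... | nothing with selected? i n
  ...   | yes _   = just tt
  ...   | no ¬sel = contradiction sel ¬sel

  eventuallyDefined : ∀ {ℓ} {A : Set ℓ} (x : ℕ → A) n → ∃[ i ] Is-just (stage x i n)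
  eventuallyDefined x n = suc ∣ n ∣ , selected⇒defined x ∣ n ∣ n (selectedNearZero n)

  oxtoby : ∀ {ℓ} {A : Set ℓ} → (ℕ → A) → ℤ → A
  oxtoby x n = to-witness (proj₂ (eventuallyDefined x n))

{-# OPTIONS --safe #-}

-- Write an element of the odometer lim ℤ/pᵢ in digits g_j < r_j = p_{j+1}/p_j, and call
-- 0 and r_j − 1 extreme.  Then z(n) = x_j for the first level j at which the digit
-- of n is extreme, so the orbit closure of z fibres over the odometer: the fibre
-- over g is a single point unless the digits of g are eventually nonextreme, and
-- if they are all nonextreme it contains, for every a in L((xᵢ)), a point with value
-- a at 0.  By continuity f maps the fibre over g into the fibre over g + h, where
-- h lies under f(z).  If h is not an integer, then the digits of g can be chosen
-- nonextreme one after the other so that infinitely many digits of g + h are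
-- extreme; this contradicts injectivity, since the fibre over g has two points and
-- the fibre over g + h only one.  So h is an integer m, and the fibre over m is
-- {S^m z′}.
module Submission where

open import Defs
open import Algebra.Bundles using (CommutativeMonoid)
import Algebra.Properties.CommutativeSemigroup
open import Axiom.ExcludedMiddle using (ExcludedMiddle)
open import Data.Integer.Base as ℤ using (ℤ; +_; -[1+_]; 0ℤ; 1ℤ; -1ℤ; ∣_∣; _/ℕ_; _%ℕ_)
open import Data.Integer.DivMod using (a≡a%ℕn+[a/ℕn]*n; n%ℕd<d; [n/ℕd]*d≤n; n<s[n/ℕd]*d)
open import Data.Integer.Divisibility.Signed using (∣ᵤ⇒∣; ∣⇒∣ᵤ)
import Data.Integer.Divisibility.Signed as Signed
import Data.Integer.Properties as ℤ
open import Data.Integer.Tactic.RingSolver using (solve-∀)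
open import Data.Maybe.Base using (Maybe; just; nothing; fromMaybe)
open import Data.Maybe using (Is-just; to-witness)
open import Data.Maybe.Properties using (just-injective)
open import Data.Maybe.Relation.Unary.Any using (just)
open import Data.Nat.Base as ℕ using (ℕ; zero; suc; _≤_; _<_; z≤n; s≤s; NonZero; >-nonZero)
open import Data.Nat.Coprimality using (1-coprimeTo)
import Data.Nat.Divisibility as ℕ
import Data.Nat.Properties as ℕ
open import Data.Nat.Tactic.RingSolver using () renaming (solve-∀ to ℕ-solve-∀)
open import Data.Product.Base using (∃; ∃-syntax; Σ-syntax; _×_; _,_; proj₁; proj₂)
open import Data.Rational.Base as ℚ using (ℚ; mkℚ; 0ℚ)
import Data.Rational.Properties as ℚ
open import Data.Sum.Base using (_⊎_; inj₁; inj₂)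
open import Function.Bundles using (Inverse)
open import Function.Metric.Structures using (IsGeneralMetric)
open import Level using (0ℓ; Lift; lift) renaming (lower to unlift)
open import Relation.Binary.PropositionalEquality using (_≡_; refl; sym; trans; cong; cong₂; subst; subst₂)
open import Relation.Nullary using (¬_; yes; no)
open import Relation.Nullary.Decidable using (map′; decidable-stable)
open import Relation.Nullary.Negation using (contradiction)

-- Floor division and windows around multiples.

-- Reduces an inequality to a known one plus an identity of differences, left to the ring solver.
linear-≤ : ∀ {a b} i j → a ℤ.≤ b → j ℤ.- i ≡ b ℤ.- a → i ℤ.≤ j
linear-≤ {a} {b} i j a≤b eq = ℤ.0≤i-j⇒j≤i (subst (0ℤ ℤ.≤_) (sym eq) (ℤ.i≤j⇒0≤j-i a≤b))

linear-< : ∀ {a b} i j → a ℤ.< b → j ℤ.- i ≡ b ℤ.- a → i ℤ.< j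
linear-< {a} {b} i j a<b eq =
  subst₂ ℤ._<_ left right (ℤ.+-monoˡ-< (i ℤ.- a) a<b)
  where
  cancel : ∀ i j → i ℤ.+ (j ℤ.- i) ≡ j
  cancel = solve-∀
  left : a ℤ.+ (i ℤ.- a) ≡ i
  left = cancel a i
  right : b ℤ.+ (i ℤ.- a) ≡ j
  right = trans (regroup a b i) (trans (cong (ℤ._+_ i) (sym eq)) (cancel i j))
    where
    regroup : ∀ a b i → b ℤ.+ (i ℤ.- a) ≡ i ℤ.+ (b ℤ.- a)
    regroup = solve-∀

/ℕ-unique : ∀ n d .{{_ : NonZero d}} c →
            c ℤ.* + d ℤ.≤ n → n ℤ.< (1ℤ ℤ.+ c) ℤ.* + d → n /ℕ d ≡ c
/ℕ-unique n d c c*d≤n n<c*d+d = ℤ.≤-antisym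
  (quotient≤ (n /ℕ d) c ([n/ℕd]*d≤n n d) n<c*d+d)
  (quotient≤ c (n /ℕ d) c*d≤n (n<s[n/ℕd]*d n d))
  where
  quotient≤ : ∀ a b → a ℤ.* + d ℤ.≤ n → n ℤ.< (1ℤ ℤ.+ b) ℤ.* + d → a ℤ.≤ b
  quotient≤ a b lo hi = subst (a ℤ.≤_) (ℤ.pred-suc b)
    (ℤ.i<j⇒i≤pred[j] (ℤ.*-cancelʳ-<-nonNeg {a} {1ℤ ℤ.+ b} (+ d) (ℤ.≤-<-trans lo hi)))

-∣i∣≤i : ∀ i → ℤ.- + ∣ i ∣ ℤ.≤ i
-∣i∣≤i (+ zero)  = ℤ.+≤+ z≤n
-∣i∣≤i (+ suc n) = ℤ.-≤+
-∣i∣≤i -[1+ n ]  = ℤ.≤-refl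

i≤∣i∣ : ∀ i → i ℤ.≤ + ∣ i ∣
i≤∣i∣ (+ n)    = ℤ.≤-refl
i≤∣i∣ -[1+ n ] = ℤ.-≤+

Around : ℤ → ℤ → ℤ → Set
Around w m n = ∃[ q ] (q ℤ.* m ℤ.≤ n ℤ.+ w × n ℤ.< q ℤ.* m ℤ.+ w)

-- Leaving the window [-b , b) modulo r b by at most a puts n within a of b or -b,
-- hence within a of a multiple of b.
around-shift : ∀ a b r n i → 0ℤ ℤ.≤ a → ℤ.- a ℤ.≤ i → i ℤ.≤ a →
               Around b (r ℤ.* b) n →
               Around b (r ℤ.* b) (n ℤ.+ i) ⊎ Around a b (n ℤ.+ i)
around-shift a b r n i 0≤a -a≤i i≤a (q , lo , hi)
  with q ℤ.* (r ℤ.* b) ℤ.≤? (n ℤ.+ i) ℤ.+ b | (n ℤ.+ i) ℤ.<? q ℤ.* (r ℤ.* b) ℤ.+ b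
... | yes lo′ | yes hi′ = inj₁ (q , lo′ , hi′)
... | no ¬lo | _ = inj₂ (q ℤ.* r ℤ.- 1ℤ
  , linear-≤ _ _ (ℤ.+-mono-≤ lo -a≤i) (eq₁ a b r n i q)
  , linear-< _ _ (ℤ.+-mono-<-≤ (ℤ.≰⇒> ¬lo) 0≤a) (eq₂ a b r n i q))
  where
  eq₁ : ∀ a b r n i q → (n ℤ.+ i ℤ.+ a) ℤ.- (q ℤ.* r ℤ.- 1ℤ) ℤ.* b
                      ≡ (n ℤ.+ b ℤ.+ i) ℤ.- (q ℤ.* (r ℤ.* b) ℤ.+ ℤ.- a)
  eq₁ = solve-∀
  eq₂ : ∀ a b r n i q → ((q ℤ.* r ℤ.- 1ℤ) ℤ.* b ℤ.+ a) ℤ.- (n ℤ.+ i)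
                      ≡ (q ℤ.* (r ℤ.* b) ℤ.+ a) ℤ.- (n ℤ.+ i ℤ.+ b ℤ.+ 0ℤ)
  eq₂ = solve-∀
... | yes _ | no ¬hi = inj₂ (q ℤ.* r ℤ.+ 1ℤ
  , linear-≤ _ _ (ℤ.+-mono-≤ (ℤ.≮⇒≥ ¬hi) 0≤a) (eq₁ a b r n i q)
  , linear-< _ _ (ℤ.+-mono-<-≤ hi i≤a) (eq₂ a b r n i q))
  where
  eq₁ : ∀ a b r n i q → (n ℤ.+ i ℤ.+ a) ℤ.- (q ℤ.* r ℤ.+ 1ℤ) ℤ.* b
                      ≡ (n ℤ.+ i ℤ.+ a) ℤ.- (q ℤ.* (r ℤ.* b) ℤ.+ b ℤ.+ 0ℤ)
  eq₁ = solve-∀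
  eq₂ : ∀ a b r n i q → ((q ℤ.* r ℤ.+ 1ℤ) ℤ.* b ℤ.+ a) ℤ.- (n ℤ.+ i)
                      ≡ (q ℤ.* (r ℤ.* b) ℤ.+ b ℤ.+ a) ℤ.- (n ℤ.+ i)
  eq₂ = solve-∀

-- Congruences with an explicit factor.

infix 4 _≡_⟨mod_⟩

record _≡_⟨mod_⟩ (a b : ℤ) (m : ℕ) : Set where
  constructor by
  field
    factor   : ℤ
    equation : a ≡ b ℤ.+ factor ℤ.* + m

≡mod-refl : ∀ {m} a → a ≡ a ⟨mod m ⟩
≡mod-refl a = by 0ℤ (sym (ℤ.+-identityʳ a))

≡mod-sym : ∀ {a b m} → a ≡ b ⟨mod m ⟩ → b ≡ a ⟨mod m ⟩
≡mod-sym {b = b} {m} (by c refl) = by (ℤ.- c) (eq b c (+ m))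
  where
  eq : ∀ b c m → b ≡ (b ℤ.+ c ℤ.* m) ℤ.+ ℤ.- c ℤ.* m
  eq = solve-∀

≡mod-trans : ∀ {a b c m} → a ≡ b ⟨mod m ⟩ → b ≡ c ⟨mod m ⟩ → a ≡ c ⟨mod m ⟩
≡mod-trans {c = c} {m} (by k refl) (by l refl) = by (l ℤ.+ k) (eq c l k (+ m))
  where
  eq : ∀ c l k m → (c ℤ.+ l ℤ.* m) ℤ.+ k ℤ.* m ≡ c ℤ.+ (l ℤ.+ k) ℤ.* m
  eq = solve-∀

≡mod-+ : ∀ {a b c e m} → a ≡ b ⟨mod m ⟩ → c ≡ e ⟨mod m ⟩ → a ℤ.+ c ≡ b ℤ.+ e ⟨mod m ⟩
≡mod-+ {b = b} {e = e} {m} (by k refl) (by l refl) = by (k ℤ.+ l) (eq b e k l (+ m))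
  where
  eq : ∀ b e k l m → (b ℤ.+ k ℤ.* m) ℤ.+ (e ℤ.+ l ℤ.* m) ≡ (b ℤ.+ e) ℤ.+ (k ℤ.+ l) ℤ.* m
  eq = solve-∀

≡mod-coarsen : ∀ {a b m n} → m ℕ.∣ n → a ≡ b ⟨mod n ⟩ → a ≡ b ⟨mod m ⟩
≡mod-coarsen {b = b} {m} (ℕ.divides k refl) (by c refl) =
  by (c ℤ.* + k) (trans (cong (λ t → b ℤ.+ c ℤ.* t) (ℤ.pos-* k m)) (eq b c (+ k) (+ m)))
  where
  eq : ∀ b c k m → b ℤ.+ c ℤ.* (k ℤ.* m) ≡ b ℤ.+ (c ℤ.* k) ℤ.* m
  eq = solve-∀

mod⇒⟨mod⟩ : ∀ a b {m} → a ≡ b [mod m ] → a ≡ b ⟨mod m ⟩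
mod⇒⟨mod⟩ a b {m} m∣a-b with ∣ᵤ⇒∣ {+ m} {a ℤ.- b} m∣a-b
... | Signed.divides c eq = by c (trans (cancel a b) (cong (ℤ._+_ b) eq))
  where
  cancel : ∀ a b → a ≡ b ℤ.+ (a ℤ.- b)
  cancel = solve-∀

⟨mod⟩⇒mod : ∀ a b {m} → a ≡ b ⟨mod m ⟩ → a ≡ b [mod m ]
⟨mod⟩⇒mod a b {m} (by c refl) =
  ∣⇒∣ᵤ (Signed.divides c (cancel b (c ℤ.* + m)))
  where
  cancel : ∀ b e → (b ℤ.+ e) ℤ.- b ≡ e
  cancel = solve-∀

around-≡mod : ∀ {w n n′} m → n′ ≡ n ⟨mod m ⟩ → Around w (+ m) n → Around w (+ m) n′
around-≡mod {w} {n} m (by c refl) (q , lo , hi) =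
  q ℤ.+ c , linear-≤ _ _ lo (eq₁ q c n w (+ m)) , linear-< _ _ hi (eq₂ q c n w (+ m))
  where
  eq₁ : ∀ q c n w m → ((n ℤ.+ c ℤ.* m) ℤ.+ w) ℤ.- (q ℤ.+ c) ℤ.* m ≡ (n ℤ.+ w) ℤ.- q ℤ.* m
  eq₁ = solve-∀
  eq₂ : ∀ q c n w m → ((q ℤ.+ c) ℤ.* m ℤ.+ w) ℤ.- (n ℤ.+ c ℤ.* m) ≡ (q ℤ.* m ℤ.+ w) ℤ.- n
  eq₂ = solve-∀

-- Selection and stages level by level.

module Levels {p : ℕ → ℕ} (fg : FastGrowing p) where
  open FastGrowing fg

  p-suc : ∀ j → p (suc j) ≡ ratio j ℕ.* p j
  p-suc j = ℕ._∣_.equality (divides j)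

  +p-suc : ∀ j → + p (suc j) ≡ + ratio j ℤ.* + p j
  +p-suc j = trans (cong +_ (p-suc j)) (ℤ.pos-* (ratio j) (p j))

  p∣p : ∀ {i j} → i ≤ j → p i ℕ.∣ p j
  p∣p i≤j = go (ℕ.≤⇒≤′ i≤j)
    where
    go : ∀ {i j} → i ℕ.≤′ j → p i ℕ.∣ p j
    go ℕ.≤′-refl       = ℕ.∣-refl
    go (ℕ.≤′-step i≤j) = ℕ.∣-trans (go i≤j) (divides _)

  p-mono : ∀ {i j} → i ≤ j → p i ≤ p j
  p-mono {j = j} i≤j = ℕ.∣⇒≤ (p∣p i≤j)

  -- The block classes -1 and 0 are adjacent, so the selected positions fill half-open windows of
  -- radius `p j` around the multiples of `p (suc j)`.
  NearMultiple : ℕ → ℤ → Set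
  NearMultiple j = Around (+ p j) (+ p (suc j))

  selected⇒near : ∀ j n → Selected fg j n → NearMultiple j n
  selected⇒near j n (inj₁ b≡-1) with mod⇒⟨mod⟩ (block fg j n) -1ℤ b≡-1
  ... | by c eq = c , linear-≤ _ _ ([n/ℕd]*d≤n n (p j)) (trans
                       (cong (λ t → (n ℤ.+ + p j) ℤ.- c ℤ.* t) (+p-suc j))
                       (trans (eq₁ n (+ p j) c (+ ratio j)) (cong (λ t → n ℤ.- t ℤ.* + p j) (sym eq))))
                   , linear-< _ _ (ℤ.<-≤-trans (n<s[n/ℕd]*d n (p j)) (ℤ.i≤i+j _ (+ p j))) (trans
                       (cong (λ t → (c ℤ.* t ℤ.+ + p j) ℤ.- n) (+p-suc j))
                       (trans (eq₂ n (+ p j) c (+ ratio j)) (cong (λ t → ((1ℤ ℤ.+ t) ℤ.* + p j ℤ.+ + p j) ℤ.- n) (sym eq))))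
    where
    eq₁ : ∀ n w c r → (n ℤ.+ w) ℤ.- c ℤ.* (r ℤ.* w) ≡ n ℤ.- (-1ℤ ℤ.+ c ℤ.* r) ℤ.* w
    eq₁ = solve-∀
    eq₂ : ∀ n w c r → (c ℤ.* (r ℤ.* w) ℤ.+ w) ℤ.- n ≡ ((1ℤ ℤ.+ (-1ℤ ℤ.+ c ℤ.* r)) ℤ.* w ℤ.+ w) ℤ.- n
    eq₂ = solve-∀
  selected⇒near j n (inj₂ b≡0) with mod⇒⟨mod⟩ (block fg j n) 0ℤ b≡0
  ... | by c eq = c , linear-≤ _ _ (ℤ.≤-trans ([n/ℕd]*d≤n n (p j)) (ℤ.i≤i+j _ (+ p j))) (trans
                       (cong (λ t → (n ℤ.+ + p j) ℤ.- c ℤ.* t) (+p-suc j))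
                       (trans (eq₁ n (+ p j) c (+ ratio j)) (cong (λ t → (n ℤ.+ + p j) ℤ.- t ℤ.* + p j) (sym eq))))
                   , linear-< _ _ (n<s[n/ℕd]*d n (p j)) (trans
                       (cong (λ t → (c ℤ.* t ℤ.+ + p j) ℤ.- n) (+p-suc j))
                       (trans (eq₂ n (+ p j) c (+ ratio j)) (cong (λ t → ((1ℤ ℤ.+ t) ℤ.* + p j) ℤ.- n) (sym eq))))
    where
    eq₁ : ∀ n w c r → (n ℤ.+ w) ℤ.- c ℤ.* (r ℤ.* w) ≡ (n ℤ.+ w) ℤ.- (0ℤ ℤ.+ c ℤ.* r) ℤ.* w
    eq₁ = solve-∀
    eq₂ : ∀ n w c r → (c ℤ.* (r ℤ.* w) ℤ.+ w) ℤ.- n ≡ ((1ℤ ℤ.+ (0ℤ ℤ.+ c ℤ.* r)) ℤ.* w) ℤ.- n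
    eq₂ = solve-∀

  near⇒selected : ∀ j n → NearMultiple j n → Selected fg j n
  near⇒selected j n (q , lo , hi) with q ℤ.* + p (suc j) ℤ.≤? n
  ... | yes lo′ = inj₂ (subst (λ b → b ≡ 0ℤ [mod ratio j ])
          (sym (/ℕ-unique n (p j) (q ℤ.* + ratio j)
            (linear-≤ _ _ lo′ (trans (eq₁ n (+ p j) q (+ ratio j)) (cong (λ t → n ℤ.- q ℤ.* t) (sym (+p-suc j)))))
            (linear-< _ _ hi (trans (eq₂ n (+ p j) q (+ ratio j)) (cong (λ t → (q ℤ.* t ℤ.+ + p j) ℤ.- n) (sym (+p-suc j)))))))
          (⟨mod⟩⇒mod (q ℤ.* + ratio j) 0ℤ (by q (sym (ℤ.+-identityˡ _)))))
    where
    eq₁ : ∀ n w c r → n ℤ.- (c ℤ.* r) ℤ.* w ≡ n ℤ.- c ℤ.* (r ℤ.* w)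
    eq₁ = solve-∀
    eq₂ : ∀ n w c r → (1ℤ ℤ.+ c ℤ.* r) ℤ.* w ℤ.- n ≡ (c ℤ.* (r ℤ.* w) ℤ.+ w) ℤ.- n
    eq₂ = solve-∀
  ... | no ¬lo = inj₁ (subst (λ b → b ≡ -1ℤ [mod ratio j ])
          (sym (/ℕ-unique n (p j) (-1ℤ ℤ.+ q ℤ.* + ratio j)
            (linear-≤ _ _ lo (trans (eq₁ n (+ p j) q (+ ratio j)) (cong (λ t → (n ℤ.+ + p j) ℤ.- q ℤ.* t) (sym (+p-suc j)))))
            (linear-< _ _ (ℤ.≰⇒> ¬lo) (trans (eq₂ n (+ p j) q (+ ratio j)) (cong (λ t → q ℤ.* t ℤ.- n) (sym (+p-suc j)))))))
          (⟨mod⟩⇒mod (-1ℤ ℤ.+ q ℤ.* + ratio j) -1ℤ (by q refl)))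
    where
    eq₁ : ∀ n w c r → n ℤ.- (-1ℤ ℤ.+ c ℤ.* r) ℤ.* w ≡ (n ℤ.+ w) ℤ.- c ℤ.* (r ℤ.* w)
    eq₁ = solve-∀
    eq₂ : ∀ n w c r → (1ℤ ℤ.+ (-1ℤ ℤ.+ c ℤ.* r)) ℤ.* w ℤ.- n ≡ c ℤ.* (r ℤ.* w) ℤ.- n
    eq₂ = solve-∀

  selected-≡mod : ∀ j {n n′} → n′ ≡ n ⟨mod p (suc j) ⟩ → Selected fg j n → Selected fg j n′
  selected-≡mod j {n} {n′} n′≡n sel =
    near⇒selected j n′ (around-≡mod (p (suc j)) n′≡n (selected⇒near j n sel))

  -- A shift by at most `p j` out of a window of level `suc j` ends within `p j` of an endpoint.
  -- That endpoint is a multiple of `p (suc j)`, the centre of a window of level `j`.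
  selected-shift : ∀ j n i → ∣ i ∣ ≤ p j → Selected fg (suc j) n →
                   Selected fg (suc j) (n ℤ.+ i) ⊎ Selected fg j (n ℤ.+ i)
  selected-shift j n i ∣i∣≤p sel
    with around-shift (+ p j) (+ p (suc j)) (+ ratio (suc j)) n i (ℤ.+≤+ z≤n)
           (ℤ.≤-trans (ℤ.neg-mono-≤ (ℤ.+≤+ ∣i∣≤p)) (-∣i∣≤i i))
           (ℤ.≤-trans (i≤∣i∣ i) (ℤ.+≤+ ∣i∣≤p))
           (subst (λ m → Around (+ p (suc j)) m n) (+p-suc (suc j)) (selected⇒near (suc j) n sel))
  ... | inj₁ ar = inj₁ (near⇒selected (suc j) _
                    (subst (λ m → Around (+ p (suc j)) m (n ℤ.+ i)) (sym (+p-suc (suc j))) ar))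
  ... | inj₂ ar = inj₂ (near⇒selected j _ ar)

  module _ {ℓ} {A : Set ℓ} (x : ℕ → A) where

    stage-suc-just : ∀ i n {v} → stage fg x i n ≡ just v → stage fg x (suc i) n ≡ just v
    stage-suc-just i n eq with stage fg x i n
    ... | just _ = eq

    stage-suc-selected : ∀ i n → stage fg x i n ≡ nothing → Selected fg i n →
                         stage fg x (suc i) n ≡ just (x i)
    stage-suc-selected i n eq sel with stage fg x i n
    ... | nothing with selected? fg i n
    ...   | yes _   = refl
    ...   | no ¬sel = contradiction sel ¬sel

    stage-suc-unselected : ∀ i n → ¬ Selected fg i n → stage fg x (suc i) n ≡ stage fg x i n
    stage-suc-unselected i n ¬sel with stage fg x i n
    ... | just _  = refl
    ... | nothing with selected? fg i n
    ...   | yes sel = contradiction sel ¬sel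
    ...   | no _    = refl

    stage-defined : ∀ i n → Selected fg i n → ∃[ v ] stage fg x (suc i) n ≡ just v
    stage-defined i n sel with stage fg x (suc i) n | selected⇒defined fg x i n sel
    ... | just v | _ = v , refl

    stage-mono : ∀ {i j} n {v} → i ≤ j → stage fg x i n ≡ just v → stage fg x j n ≡ just v
    stage-mono {i} n {v} i≤j eq = go (ℕ.≤⇒≤′ i≤j)
      where
      go : ∀ {j} → i ℕ.≤′ j → stage fg x j n ≡ just v
      go ℕ.≤′-refl       = eq
      go (ℕ.≤′-step {n = k} i≤j) = stage-suc-just k n (go i≤j)

    stage-stationary : ∀ {i j} n → i ≤ j → (∀ l → i ≤ l → l < j → ¬ Selected fg l n) →
                       stage fg x j n ≡ stage fg x i n
    stage-stationary {i} {j} n i≤j ¬sel = go (ℕ.≤⇒≤′ i≤j) ℕ.≤-refl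
      where
      go : ∀ {k} → i ℕ.≤′ k → k ≤ j → stage fg x k n ≡ stage fg x i n
      go ℕ.≤′-refl               _   = refl
      go (ℕ.≤′-step {n = k} i≤k) k<j =
        trans (stage-suc-unselected k n (¬sel k (ℕ.≤′⇒≤ i≤k) k<j)) (go i≤k (ℕ.<⇒≤ k<j))

    -- Stage `i` consults only levels `l < i`, where selection has period `p (suc l)`, a divisor of
    -- `p i`. Hence stages make sense at points of the odometer.
    stage-≡mod : ∀ i {n n′} → n′ ≡ n ⟨mod p i ⟩ → stage fg x i n′ ≡ stage fg x i n
    stage-≡mod zero    n′≡n = refl
    stage-≡mod (suc i) {n} {n′} n′≡n
      with stage fg x i n in eq | stage fg x i n′ | stage-≡mod i (≡mod-coarsen (divides i) n′≡n)
    ... | just v  | .(just v) | refl = refl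
    ... | nothing | .nothing  | refl with selected? fg i n | selected? fg i n′
    ...   | yes _   | yes _    = refl
    ...   | no _    | no _     = refl
    ...   | yes sel | no ¬sel′ = contradiction (selected-≡mod i n′≡n sel) ¬sel′
    ...   | no ¬sel | yes sel′ = contradiction (selected-≡mod i (≡mod-sym n′≡n) sel′) ¬sel

    stage-oxtoby : ∀ i n {v} → stage fg x i n ≡ just v → oxtoby fg x n ≡ v
    stage-oxtoby i n {v} eq = just-injective (trans
      (sym (stage-mono n (ℕ.m≤n⊔m i (suc ∣ n ∣)) (witness (proj₂ (eventuallyDefined fg x n)))))
      (stage-mono n (ℕ.m≤m⊔n i (suc ∣ n ∣)) eq))
      where
      witness : ∀ {m : Maybe A} (w : Is-just m) → m ≡ just (to-witness w)
      witness (just _) = refl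

  -- Points of the odometer, by residues and digits.

  record Expansion : Set where
    field
      value     : ℕ → ℕ
      digit     : ℕ → ℕ
      digit<    : ∀ j → digit j < ratio j
      value-0   : value 0 ≡ 0
      value-suc : ∀ j → value (suc j) ≡ value j ℕ.+ digit j ℕ.* p j

    value< : ∀ j → value j < p j
    value< zero    = subst₂ _<_ (sym value-0) (sym p₀≡1) (s≤s z≤n)
    value< (suc j) = begin-strict
      value (suc j)                  ≡⟨ value-suc j ⟩
      value j ℕ.+ digit j ℕ.* p j    <⟨ ℕ.+-monoˡ-< (digit j ℕ.* p j) (value< j) ⟩
      suc (digit j) ℕ.* p j          ≤⟨ ℕ.*-monoˡ-≤ (p j) (digit< j) ⟩
      ratio j ℕ.* p j                ≡⟨ p-suc j ⟨
      p (suc j)                      ∎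
      where open ℕ.≤-Reasoning

    value-coherent : ∀ {i j} → i ≤ j → + value j ≡ + value i ⟨mod p i ⟩
    value-coherent {i} i≤j = go (ℕ.≤⇒≤′ i≤j)
      where
      go : ∀ {j} → i ℕ.≤′ j → + value j ≡ + value i ⟨mod p i ⟩
      go ℕ.≤′-refl = ≡mod-refl _
      go (ℕ.≤′-step {n = k} i≤k) = ≡mod-trans
        (≡mod-coarsen (p∣p (ℕ.≤′⇒≤ i≤k)) (by (+ digit k)
          (trans (cong +_ (value-suc k)) (cong (λ t → + value k ℤ.+ t) (ℤ.pos-* (digit k) (p k))))))
        (go i≤k)

  open Expansion public

  Nonextreme : Expansion → Set
  Nonextreme G = ∀ j → 1 ≤ digit G j × suc (suc (digit G j)) ≤ ratio j

  ≡mod-refine : ∀ j {n a} → n ≡ + a ⟨mod p j ⟩ →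
                ∃[ c ] (c < ratio j × n ≡ + (a ℕ.+ c ℕ.* p j) ⟨mod p (suc j) ⟩)
  ≡mod-refine j {n} {a} (by k eq) =
    k %ℕ ratio j , n%ℕd<d k (ratio j) , lift-residue (k %ℕ ratio j) (k /ℕ ratio j) (a≡a%ℕn+[a/ℕn]*n k (ratio j))
    where
    open Relation.Binary.PropositionalEquality.≡-Reasoning
    instance
      ratio≢0 : NonZero (ratio j)
      ratio≢0 = >-nonZero (ℕ.≤-trans (s≤s z≤n) (3≤ratio j))
    regroup : ∀ a c b r m → a ℤ.+ (c ℤ.+ b ℤ.* r) ℤ.* m ≡ a ℤ.+ c ℤ.* m ℤ.+ b ℤ.* (r ℤ.* m)
    regroup = solve-∀
    lift-residue : ∀ c b → k ≡ + c ℤ.+ b ℤ.* + ratio j → n ≡ + (a ℕ.+ c ℕ.* p j) ⟨mod p (suc j) ⟩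
    lift-residue c b k≡ = by b (begin
      n
        ≡⟨ eq ⟩
      + a ℤ.+ k ℤ.* + p j
        ≡⟨ cong (λ t → + a ℤ.+ t ℤ.* + p j) k≡ ⟩
      + a ℤ.+ (+ c ℤ.+ b ℤ.* + ratio j) ℤ.* + p j
        ≡⟨ regroup (+ a) (+ c) b (+ ratio j) (+ p j) ⟩
      + a ℤ.+ + c ℤ.* + p j ℤ.+ b ℤ.* (+ ratio j ℤ.* + p j)
        ≡⟨ cong₂ (λ s t → + a ℤ.+ s ℤ.+ b ℤ.* t) (ℤ.pos-* c (p j)) (+p-suc j) ⟨
      + (a ℕ.+ c ℕ.* p j) ℤ.+ b ℤ.* + p (suc j)
        ∎)

  -- The digit `t` is r - 1 or r, so the position lies in the block just before or just after
  -- `p (suc j)`. The value r is an overflow whose reduced digit is 0.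
  selected-near-period : ∀ j e t → e < p j → t ≤ ratio j → ratio j ≤ suc t →
                         Selected fg j (+ (e ℕ.+ t ℕ.* p j))
  selected-near-period j e t e<p t≤r r≤1+t = near⇒selected j _ (1ℤ
    , subst (ℤ._≤ + (e ℕ.+ t ℕ.* p j ℕ.+ p j)) (sym (ℤ.*-identityˡ (+ p (suc j)))) (ℤ.+≤+ lower)
    , subst (λ m → + (e ℕ.+ t ℕ.* p j) ℤ.< m ℤ.+ + p j) (sym (ℤ.*-identityˡ (+ p (suc j)))) (ℤ.+<+ upper))
    where
    open ℕ.≤-Reasoning
    lower : p (suc j) ≤ e ℕ.+ t ℕ.* p j ℕ.+ p j
    lower = begin
      p (suc j)                     ≡⟨ p-suc j ⟩
      ratio j ℕ.* p j               ≤⟨ ℕ.*-monoˡ-≤ (p j) r≤1+t ⟩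
      p j ℕ.+ t ℕ.* p j             ≡⟨ ℕ.+-comm (p j) _ ⟩
      t ℕ.* p j ℕ.+ p j             ≤⟨ ℕ.+-monoˡ-≤ (p j) (ℕ.m≤n+m (t ℕ.* p j) e) ⟩
      e ℕ.+ t ℕ.* p j ℕ.+ p j       ∎
    upper : e ℕ.+ t ℕ.* p j < p (suc j) ℕ.+ p j
    upper = begin-strict
      e ℕ.+ t ℕ.* p j               <⟨ ℕ.+-mono-<-≤ e<p (ℕ.*-monoˡ-≤ (p j) t≤r) ⟩
      p j ℕ.+ ratio j ℕ.* p j       ≡⟨ ℕ.+-comm (p j) _ ⟩
      ratio j ℕ.* p j ℕ.+ p j       ≡⟨ cong (ℕ._+ p j) (p-suc j) ⟨
      p (suc j) ℕ.+ p j             ∎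

  -- A digit at most r - 2 leaves a whole block of length `p j` free below `p (suc j)`.
  nonextreme-bound : ∀ j e g → e < p j → suc (suc g) ≤ ratio j →
                     e ℕ.+ g ℕ.* p j ℕ.+ p j < p (suc j)
  nonextreme-bound j e g e<p g+2≤r = begin-strict
    e ℕ.+ g ℕ.* p j ℕ.+ p j         ≡⟨ ℕ.+-assoc e _ _ ⟩
    e ℕ.+ (g ℕ.* p j ℕ.+ p j)       <⟨ ℕ.+-monoˡ-< _ e<p ⟩
    p j ℕ.+ (g ℕ.* p j ℕ.+ p j)     ≡⟨ cong (p j ℕ.+_) (ℕ.+-comm (g ℕ.* p j) (p j)) ⟩
    suc (suc g) ℕ.* p j             ≤⟨ ℕ.*-monoˡ-≤ (p j) g+2≤r ⟩
    ratio j ℕ.* p j                 ≡⟨ p-suc j ⟨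
    p (suc j)                       ∎
    where open ℕ.≤-Reasoning

  -- The position lies in [p_j , p_{j+1} - p_j), so a window around q p_{j+1} containing it would
  -- need both q ≤ 0 and q > 0.
  nonextreme-unselected : ∀ j e g → e < p j → 1 ≤ g → suc (suc g) ≤ ratio j →
                          ¬ Selected fg j (+ (e ℕ.+ g ℕ.* p j))
  nonextreme-unselected j e g e<p 1≤g g+2≤r sel with selected⇒near j _ sel
  ... | q , lo , hi = contradiction q≤0 (ℤ.<⇒≱ 0<q)
    where
    open ℕ.≤-Reasoning
    n = e ℕ.+ g ℕ.* p j
    n+p<p = nonextreme-bound j e g e<p g+2≤r
    p≤n : p j ≤ n
    p≤n = begin
      p j                 ≡⟨ ℕ.*-identityˡ (p j) ⟨
      1 ℕ.* p j           ≤⟨ ℕ.*-monoˡ-≤ (p j) 1≤g ⟩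
      g ℕ.* p j           ≤⟨ ℕ.m≤n+m _ e ⟩
      n                   ∎
    q≤0 : q ℤ.≤ 0ℤ
    q≤0 = ℤ.i<j⇒i≤pred[j] (ℤ.*-cancelʳ-<-nonNeg {q} {1ℤ} (+ p (suc j))
            (ℤ.≤-<-trans lo (subst (+ (n ℕ.+ p j) ℤ.<_) (sym (ℤ.*-identityˡ (+ p (suc j)))) (ℤ.+<+ n+p<p))))
    0<q : 0ℤ ℤ.< q
    0<q = ℤ.*-cancelʳ-<-nonNeg {0ℤ} {q} (+ p (suc j))
            (linear-< _ _ (ℤ.≤-<-trans (ℤ.+≤+ p≤n) hi) (eq (q ℤ.* + p (suc j)) (+ p j) (+ p (suc j))))
      where
      eq : ∀ a b c → a ℤ.- 0ℤ ℤ.* c ≡ (a ℤ.+ b) ℤ.- b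
      eq = solve-∀

  unselected : ∀ G → Nonextreme G → ∀ j → ¬ Selected fg j (+ value G (suc j))
  unselected G nx j sel = nonextreme-unselected j (value G j) (digit G j) (value< G j)
    (proj₁ (nx j)) (proj₂ (nx j)) (subst (λ n → Selected fg j (+ n)) (value-suc G j) sel)

  -- Adding t = 0 or t = r does not change a digit in base r; every other t moves
  -- some nonextreme digit g to 0 or r − 1.
  complement : ∀ r t → 3 ≤ r → t ≤ r →
               ∃[ g ] (1 ≤ g × suc (suc g) ≤ r ×
                       (t ≡ 0 ⊎ t ≡ r ⊎ (g ℕ.+ t ≤ r × r ≤ suc (g ℕ.+ t))))
  complement r zero 3≤r _ = 1 , s≤s z≤n , 3≤r , inj₁ refl
  complement (suc (suc (suc k))) 1 (s≤s (s≤s (s≤s _))) _ =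
    suc k , s≤s z≤n , ℕ.≤-refl , inj₂ (inj₂
      ( ℕ.≤-trans (ℕ.≤-reflexive (ℕ.+-comm (suc k) 1)) (ℕ.n≤1+n _)
      , ℕ.≤-reflexive (cong suc (ℕ.+-comm 1 (suc k)))))
  complement 1 1 (s≤s ()) _
  complement 2 1 (s≤s (s≤s ())) _
  complement r (suc (suc t)) 3≤r t≤r with ℕ.m≤n⇒m<n∨m≡n t≤r
  ... | inj₂ t≡r = 1 , s≤s z≤n , 3≤r , inj₂ (inj₁ t≡r)
  ... | inj₁ t<r = r ℕ.∸ suc (suc t) , ℕ.m<n⇒0<n∸m t<r
    , ℕ.≤-trans (ℕ.+-monoˡ-≤ _ (s≤s (s≤s (z≤n {t})))) (ℕ.≤-reflexive (ℕ.m+[n∸m]≡n t≤r))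
    , inj₂ (inj₂ (ℕ.≤-reflexive (ℕ.m∸n+n≡m t≤r)
                 , ℕ.≤-trans (ℕ.≤-reflexive (sym (ℕ.m∸n+n≡m t≤r))) (ℕ.n≤1+n _)))

  -- Here `e` is the sum of the lower parts, and `p j ≤ e` means a carry into level `j`. In both
  -- cases `h` plus the carry is 0 or r, the exceptional summands of `complement`.
  NoCarry FullCarry : ℕ → ℕ → ℕ → Set
  NoCarry   j e h = h ≡ 0 × e < p j
  FullCarry j e h = suc h ≡ ratio j × p j ≤ e

  -- The carry is absorbed into the summand: `complement` is applied to `h` without a carry, and to
  -- `suc h` with one, `p j` then being taken off `e`.
  complement-digit : ∀ j e h → e < p j ℕ.+ p j → h < ratio j →
    ∃[ g ] (1 ≤ g × suc (suc g) ≤ ratio j ×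
            (Selected fg j (+ (e ℕ.+ (g ℕ.+ h) ℕ.* p j)) ⊎ NoCarry j e h ⊎ FullCarry j e h))
  complement-digit j e h e<2p h<r with e ℕ.<? p j
  complement-digit j e h e<2p h<r | yes e<p with complement (ratio j) h (3≤ratio j) (ℕ.<⇒≤ h<r)
  ... | g , 1≤g , g≤ , inj₁ h≡0 = g , 1≤g , g≤ , inj₂ (inj₁ (h≡0 , e<p))
  ... | g , 1≤g , g≤ , inj₂ (inj₁ h≡r) = contradiction h≡r (ℕ.<⇒≢ h<r)
  ... | g , 1≤g , g≤ , inj₂ (inj₂ (≤r , r≤)) =
        g , 1≤g , g≤ , inj₁ (selected-near-period j e (g ℕ.+ h) e<p ≤r r≤)
  complement-digit j e h e<2p h<r | no e≮p with complement (ratio j) (suc h) (3≤ratio j) h<r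
  ... | g , 1≤g , g≤ , inj₂ (inj₁ h≡r) = g , 1≤g , g≤ , inj₂ (inj₂ (h≡r , ℕ.≮⇒≥ e≮p))
  ... | g , 1≤g , g≤ , inj₂ (inj₂ (≤r , r≤)) = g , 1≤g , g≤ , inj₁
        (subst (λ n → Selected fg j (+ n)) regroup
          (selected-near-period j (e ℕ.∸ p j) (g ℕ.+ suc h) e-p<p ≤r r≤))
    where
    p≤e = ℕ.≮⇒≥ e≮p
    e-p<p : e ℕ.∸ p j < p j
    e-p<p = ℕ.+-cancelʳ-< (p j) _ _ (subst (_< p j ℕ.+ p j) (sym (ℕ.m∸n+n≡m p≤e)) e<2p)
    regroup : e ℕ.∸ p j ℕ.+ (g ℕ.+ suc h) ℕ.* p j ≡ e ℕ.+ (g ℕ.+ h) ℕ.* p j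
    regroup = begin
      e ℕ.∸ p j ℕ.+ (g ℕ.+ suc h) ℕ.* p j            ≡⟨ cong (λ t → e ℕ.∸ p j ℕ.+ t ℕ.* p j) (ℕ.+-suc g h) ⟩
      e ℕ.∸ p j ℕ.+ (p j ℕ.+ (g ℕ.+ h) ℕ.* p j)      ≡⟨ ℕ.+-assoc (e ℕ.∸ p j) (p j) _ ⟨
      e ℕ.∸ p j ℕ.+ p j ℕ.+ (g ℕ.+ h) ℕ.* p j        ≡⟨ cong (ℕ._+ _) (ℕ.m∸n+n≡m p≤e) ⟩
      e ℕ.+ (g ℕ.+ h) ℕ.* p j                        ∎
      where open Relation.Binary.PropositionalEquality.≡-Reasoning

  -- A nonextreme G chosen against H, and integrality of H.

  module Complement (H : Expansion) where
    open ℕ.≤-Reasoning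

    sum<2p : ∀ j (s : Σ[ g ∈ ℕ ] g < p j) → proj₁ s ℕ.+ value H j < p j ℕ.+ p j
    sum<2p j (g , g<p) = ℕ.+-mono-< g<p (value< H j)

    next : ∀ j (s : Σ[ g ∈ ℕ ] g < p j) → _
    next j s = complement-digit j (proj₁ s ℕ.+ value H j) (digit H j) (sum<2p j s) (digit< H j)

    state : ∀ j → Σ[ g ∈ ℕ ] g < p j
    state zero    = 0 , subst (0 <_) (sym p₀≡1) (s≤s z≤n)
    state (suc j) = let (g , g<p) = state j ; (d , _ , d≤ , _) = next j (state j) in
      g ℕ.+ d ℕ.* p j , (begin-strict
        g ℕ.+ d ℕ.* p j    <⟨ ℕ.+-monoˡ-< _ g<p ⟩
        suc d ℕ.* p j      ≤⟨ ℕ.*-monoˡ-≤ (p j) (ℕ.≤-trans (ℕ.n≤1+n _) d≤) ⟩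
        ratio j ℕ.* p j    ≡⟨ p-suc j ⟨
        p (suc j)          ∎)

    G : Expansion
    G = record
      { value     = λ j → proj₁ (state j)
      ; digit     = λ j → proj₁ (next j (state j))
      ; digit<    = λ j → ℕ.≤-trans (ℕ.n≤1+n _) (proj₁ (proj₂ (proj₂ (next j (state j)))))
      ; value-0   = refl
      ; value-suc = λ j → refl
      }

    G-nonextreme : Nonextreme G
    G-nonextreme j = proj₁ (proj₂ (next j (state j))) , proj₁ (proj₂ (proj₂ (next j (state j))))

    -- The residues of G + H, left unreduced: `E j` reaches `p j` exactly when a carry enters level
    -- `j`.
    E : ℕ → ℕ
    E j = value G j ℕ.+ value H j

    E-suc : ∀ j → E (suc j) ≡ E j ℕ.+ (digit G j ℕ.+ digit H j) ℕ.* p j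
    E-suc j = trans (cong (value G (suc j) ℕ.+_) (value-suc H j))
      (regroup (value G j) (digit G j) (p j) (value H j) (digit H j))
      where
      regroup : ∀ a b p c d → (a ℕ.+ b ℕ.* p) ℕ.+ (c ℕ.+ d ℕ.* p) ≡ (a ℕ.+ c) ℕ.+ (b ℕ.+ d) ℕ.* p
      regroup = ℕ-solve-∀

    trichotomy : ∀ j → Selected fg j (+ E (suc j)) ⊎ NoCarry j (E j) (digit H j) ⊎ FullCarry j (E j) (digit H j)
    trichotomy j with proj₂ (proj₂ (proj₂ (next j (state j))))
    ... | inj₁ sel = inj₁ (subst (λ n → Selected fg j (+ n)) (sym (E-suc j)) sel)
    ... | inj₂ c   = inj₂ c

    noCarry-persists : ∀ j → NoCarry j (E j) (digit H j) → E (suc j) < p (suc j)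
    noCarry-persists j (h≡0 , E<p) = begin-strict
      E (suc j)                                      ≡⟨ E-suc j ⟩
      E j ℕ.+ (digit G j ℕ.+ digit H j) ℕ.* p j      ≡⟨ cong (λ h → E j ℕ.+ (digit G j ℕ.+ h) ℕ.* p j) h≡0 ⟩
      E j ℕ.+ (digit G j ℕ.+ 0) ℕ.* p j              ≡⟨ cong (λ g → E j ℕ.+ g ℕ.* p j) (ℕ.+-identityʳ (digit G j)) ⟩
      E j ℕ.+ digit G j ℕ.* p j                      <⟨ ℕ.+-monoˡ-< _ E<p ⟩
      suc (digit G j) ℕ.* p j                        ≤⟨ ℕ.*-monoˡ-≤ (p j) (digit< G j) ⟩
      ratio j ℕ.* p j                                ≡⟨ p-suc j ⟨
      p (suc j)                                      ∎

    fullCarry-persists : ∀ j → FullCarry j (E j) (digit H j) → p (suc j) ≤ E (suc j)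
    fullCarry-persists j (h≡r , p≤E) = begin
      p (suc j)                                      ≡⟨ p-suc j ⟩
      ratio j ℕ.* p j                                ≡⟨ cong (ℕ._* p j) h≡r ⟨
      p j ℕ.+ digit H j ℕ.* p j                      ≤⟨ ℕ.+-mono-≤ p≤E (ℕ.*-monoˡ-≤ (p j) (ℕ.m≤n+m (digit H j) (digit G j))) ⟩
      E j ℕ.+ (digit G j ℕ.+ digit H j) ℕ.* p j      ≡⟨ E-suc j ⟨
      E (suc j)                                      ∎

    -- Without a carry at `J` only `NoCarry` can occur from there on, so all further digits of H are
    -- 0 and H is a natural number.
    noCarry-tail : ∀ J → (∀ j → J ≤ j → ¬ Selected fg j (+ E (suc j))) → E J < p J →
                   ∀ j → J ≤ j → + value H j ≡ + value H J ⟨mod p j ⟩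
    noCarry-tail J ¬sel E<p j J≤j = subst (λ n → + n ≡ + value H J ⟨mod p j ⟩) (sym (proj₂ (go (ℕ.≤⇒≤′ J≤j)))) (≡mod-refl _)
      where
      go : ∀ {j} → J ℕ.≤′ j → E j < p j × value H j ≡ value H J
      go ℕ.≤′-refl = E<p , refl
      go (ℕ.≤′-step {n = k} J≤k) with go J≤k | trichotomy k
      ... | _ , _ | inj₁ sel = contradiction sel (¬sel k (ℕ.≤′⇒≤ J≤k))
      ... | _ , eq | inj₂ (inj₁ nc@(h≡0 , _)) = noCarry-persists k nc
            , trans (value-suc H k) (trans (cong (λ h → value H k ℕ.+ h ℕ.* p k) h≡0) (trans (ℕ.+-identityʳ _) eq))
      ... | lt , _ | inj₂ (inj₂ (_ , p≤E)) = contradiction p≤E (ℕ.<⇒≱ lt)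

    -- With a carry at `J` only `FullCarry` can occur from there on, so all further digits of H are
    -- r - 1, as in the expansion of a negative integer.
    fullCarry-tail : ∀ J → (∀ j → J ≤ j → ¬ Selected fg j (+ E (suc j))) → p J ≤ E J →
                     ∀ j → J ≤ j → + value H j ≡ + value H J ℤ.- + p J ⟨mod p j ⟩
    fullCarry-tail J ¬sel p≤E j J≤j = by 1ℤ (trans (cancel (+ value H j) (+ p j))
        (cong (ℤ._+ (1ℤ ℤ.* + p j)) (proj₂ (go (ℕ.≤⇒≤′ J≤j)))))
      where
      cancel : ∀ a b → a ≡ (a ℤ.- b) ℤ.+ 1ℤ ℤ.* b
      cancel = solve-∀
      go : ∀ {j} → J ℕ.≤′ j → p j ≤ E j × + value H j ℤ.- + p j ≡ + value H J ℤ.- + p J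
      go ℕ.≤′-refl = p≤E , refl
      go (ℕ.≤′-step {n = k} J≤k) with go J≤k | trichotomy k
      ... | _ , _ | inj₁ sel = contradiction sel (¬sel k (ℕ.≤′⇒≤ J≤k))
      ... | le , _ | inj₂ (inj₁ (_ , E<p)) = contradiction le (ℕ.<⇒≱ E<p)
      ... | _ , eq | inj₂ (inj₂ fc@(h≡r , _)) = fullCarry-persists k fc , trans step eq
        where
        -- With r = h + 1, both `value H` and `p` grow by h p_k.
        step : + value H (suc k) ℤ.- + p (suc k) ≡ + value H k ℤ.- + p k
        step = trans (cong₂ (λ a b → + a ℤ.- + b) (value-suc H k) (trans (p-suc k) (cong (ℕ._* p k) (sym h≡r))))
          (cancel′ (+ value H k) (+ (digit H k ℕ.* p k)) (+ p k))
          where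
          cancel′ : ∀ a b c → (a ℤ.+ b) ℤ.- (c ℤ.+ b) ≡ a ℤ.- c
          cancel′ = solve-∀

    integer : ∀ J → (∀ j → J ≤ j → ¬ Selected fg j (+ E (suc j))) →
              ∃[ m ] (∀ j → J ≤ j → + value H j ≡ m ⟨mod p j ⟩)
    integer J ¬sel with E J ℕ.<? p J
    ... | yes E<p = _ , noCarry-tail J ¬sel E<p
    ... | no  E≮p = _ , fullCarry-tail J ¬sel (ℕ.≮⇒≥ E≮p)

    -- A selected position stays selected, at its level or the one below, after a shift that is
    -- small for that level. With `limitOver-value` this leaves at most one point over G + H.
    eventually-defined : ∀ {ℓ} {A : Set ℓ} (x : ℕ → A) →
      (∀ J → ∃[ j ] (J ≤ j × Selected fg j (+ E (suc j)))) →
      ∀ i → ∃[ J ] ∃[ v ] stage fg x J (+ E J ℤ.+ i) ≡ just v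
    -- A level above `∣ i ∣` is a successor `suc l` with `∣ i ∣ ≤ l < p l`, as `selected-shift`
    -- requires.
    eventually-defined x often i with often (suc ∣ i ∣)
    ... | suc l , s≤s ∣i∣≤l , sel
      with selected-shift l (+ E (suc (suc l))) i (ℕ.≤-trans ∣i∣≤l (ℕ.<⇒≤ (i<pᵢ l))) sel
    ...   | inj₁ sel′ = suc (suc l) , stage-defined x (suc l) (+ E (suc (suc l)) ℤ.+ i) sel′
    ...   | inj₂ sel′ =
      let n = + E (suc (suc l)) ℤ.+ i
          (v , eq) = stage-defined x l n sel′
      in suc (suc l) , v , stage-suc-just x (suc l) n eq

-- Estimates for Cauchy reals.

0<ᵣfromℚ : ∀ {q} → 0ℚ ℚ.< q → 0ᵣ <ᵣ fromℚ q
0<ᵣfromℚ {q} 0<q = q , 0<q , 0 , λ _ _ → ℚ.≤-reflexive (ℚ.+-identityˡ q)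

<ᵣ-≤-trans : ∀ x {q r} → q ℚ.≤ r → x <ᵣ fromℚ q → x <ᵣ fromℚ r
<ᵣ-≤-trans x q≤r (η , 0<η , N , lt) = η , 0<η , N , λ n N≤n → ℚ.≤-trans (lt n N≤n) q≤r

rational-below : ∀ ε → 0ᵣ <ᵣ ε → ∃[ q ] (0ℚ ℚ.< q × (∀ x → x <ᵣ fromℚ q → x <ᵣ ε))
rational-below ε (δ , 0<δ , M , δ≤ε) = δ , 0<δ , λ x (η , 0<η , N , lt) →
  η , 0<η , M ℕ.⊔ N , λ n M⊔N≤n → ℚ.≤-trans (lt n (ℕ.m⊔n≤o⇒n≤o M N M⊔N≤n))
    (ℚ.≤-trans (ℚ.≤-reflexive (sym (ℚ.+-identityˡ δ))) (δ≤ε n (ℕ.m⊔n≤o⇒m≤o M N M⊔N≤n)))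

≤ᵣ-<ᵣ-trans : ∀ x y z → x ≤ᵣ y → y <ᵣ z → x <ᵣ z
≤ᵣ-<ᵣ-trans x y z x≤y (η , 0<η , M , lt) =
  let (N , le) = x≤y (half η) (0<half 0<η)
      open ℚ.≤-Reasoning
  in half η , 0<half 0<η , M ℕ.⊔ N , λ n M⊔N≤n → begin
       seq x n ℚ.+ half η               ≤⟨ ℚ.+-monoˡ-≤ (half η) (le n (ℕ.m⊔n≤o⇒n≤o M N M⊔N≤n)) ⟩
       seq y n ℚ.+ half η ℚ.+ half η    ≡⟨ ℚ.+-assoc (seq y n) _ _ ⟩
       seq y n ℚ.+ (half η ℚ.+ half η)  ≡⟨ cong (seq y n ℚ.+_) (half+half η) ⟩
       seq y n ℚ.+ η                    ≤⟨ lt n (ℕ.m⊔n≤o⇒m≤o M N M⊔N≤n) ⟩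
       seq z n                          ∎

+ᵣ-mono-<ᵣ : ∀ x y {q r} → x <ᵣ fromℚ q → y <ᵣ fromℚ r → x +ᵣ y <ᵣ fromℚ (q ℚ.+ r)
+ᵣ-mono-<ᵣ x y (η , 0<η , M , lt) (θ , 0<θ , N , lt′) =
  η ℚ.+ θ , ℚ.+-mono-< 0<η 0<θ , M ℕ.⊔ N , λ n M⊔N≤n →
    ℚ.≤-trans (ℚ.≤-reflexive (interchange-+ (seq x n) (seq y n) η θ))
      (ℚ.+-mono-≤ (lt n (ℕ.m⊔n≤o⇒m≤o M N M⊔N≤n)) (lt′ n (ℕ.m⊔n≤o⇒n≤o M N M⊔N≤n)))
  where
  open Algebra.Properties.CommutativeSemigroup
    (CommutativeMonoid.commutativeSemigroup ℚ.+-0-commutativeMonoid)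
    renaming (interchange to interchange-+)

-- `mkℚ` stores the denominator minus one, so this is 1/(n+1).
unitFraction : ℕ → ℚ
unitFraction n = mkℚ (+ 1) n (1-coprimeTo (suc n))

archimedean : ∀ q → 0ℚ ℚ.< q → ∃[ N ] (∀ M → N ≤ M → unitFraction M ℚ.≤ q)
archimedean (mkℚ (+ suc k) e _) _ = e , λ M e≤M → ℚ.*≤*
  (ℤ.+≤+ (ℕ.≤-trans (ℕ.≤-reflexive (ℕ.+-identityʳ (suc e)))
    (ℕ.≤-trans (s≤s e≤M) (ℕ.m≤m+n (suc M) (k ℕ.* suc M)))))
archimedean (mkℚ (+ 0) _ _) (ℚ.*<* (ℤ.+<+ ()))
archimedean (mkℚ -[1+ _ ] _ _) (ℚ.*<* ())

-- Infinite pigeonhole principle.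

module Classical (em : ExcludedMiddle 0ℓ) where

  eventually-or-often : (Q : ℕ → Set) →
    (∃[ N ] (∀ M → N ≤ M → ¬ Q M)) ⊎ (∀ N → ∃[ M ] (N ≤ M × Q M))
  eventually-or-often Q with em {∃[ N ] (∀ M → N ≤ M → ¬ Q M)}
  ... | yes eventually = inj₁ eventually
  ... | no ¬eventually = inj₂ λ N → decidable-stable em λ ¬often →
          ¬eventually (N , λ M N≤M QM → ¬often (M , N≤M , QM))

  -- Induction on the number of colours: either the last colour recurs for ever, or it dies out and
  -- the search continues beyond that point with the remaining `r`.
  pigeonhole : ∀ r (Q : ℕ → ℕ → Set) →
    (∀ N → ∃[ M ] (N ≤ M × ∃[ c ] (c < r × Q c M))) →
    ∃[ c ] (c < r × (∀ N → ∃[ M ] (N ≤ M × Q c M)))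
  pigeonhole zero Q often with often 0
  ... | _ , _ , _ , () , _
  pigeonhole (suc r) Q often with eventually-or-often (Q r)
  ... | inj₂ r-often = r , ℕ.≤-refl , r-often
  ... | inj₁ (N₀ , ¬r) = let (c , c<r , c-often) = pigeonhole r Q smaller in c , ℕ.m<n⇒m<1+n c<r , c-often
    where
    smaller : ∀ N → ∃[ M ] (N ≤ M × ∃[ c ] (c < r × Q c M))
    smaller N with often (N₀ ℕ.⊔ N)
    ... | M , le , c , c<1+r , Qc with ℕ.m≤n⇒m<n∨m≡n (ℕ.s≤s⁻¹ c<1+r)
    ...   | inj₁ c<r  = M , ℕ.m⊔n≤o⇒n≤o N₀ N le , c , c<r , Qc
    ...   | inj₂ refl = contradiction Qc (¬r M (ℕ.m⊔n≤o⇒m≤o N₀ N le))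

-- Limits of shifts and the odometer points under them.

module Dynamics {ℓ} (X : MetricSpace ℓ) {p : ℕ → ℕ} (fg : FastGrowing p) where
  open MetricSpace X
  open IsGeneralMetric isMetric using (nonNegative; antisym; reflexive) renaming (sym to d-sym)
  open FastGrowing fg
  open Levels fg

  d-refl : ∀ {a b} ε → 0ᵣ <ᵣ ε → a ≡ b → d a b <ᵣ ε
  d-refl {a} ε 0<ε refl = ≈0⇒< (d a a) ε (≈⇒0 EqC.refl) 0<ε

  d-comm-< : ∀ a b ε → d a b <ᵣ ε → d b a <ᵣ ε
  d-comm-< a b ε = ≤ᵣ-<ᵣ-trans (d b a) (d a b) ε (reflexive {d b a} {d a b} (d-sym b a))

  d-respʳ-< : ∀ a {b c} ε → b ≈ c → d a b <ᵣ ε → d a c <ᵣ ε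
  d-respʳ-< a {b} {c} ε b≈c = ≤ᵣ-<ᵣ-trans (d a c) (d a b) ε
    (reflexive {d a c} {d a b} (IsGeneralMetric.cong isMetric (EqC.refl {a}) (EqC.sym b≈c)))

  d-triangle-< : ∀ a b c q → d a b <ᵣ fromℚ (half q) → d b c <ᵣ fromℚ (half q) → d a c <ᵣ fromℚ q
  d-triangle-< a b c q ab bc = subst (λ r → d a c <ᵣ fromℚ r) (half+half q)
    (≤ᵣ-<ᵣ-trans (d a c) (d a b +ᵣ d b c) (fromℚ (half q ℚ.+ half q)) (triangle a b c)
      (+ᵣ-mono-<ᵣ (d a b) (d b c) ab bc))

  arbitrarilyClose⇒≈ : ∀ {a b} → (∀ q → 0ℚ ℚ.< q → d a b <ᵣ fromℚ q) → a ≈ b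
  arbitrarilyClose⇒≈ {a} {b} close = 0⇒≈ (antisym {d a b} {0ᵣ} ab≤0 (nonNegative {a} {b}))
    where
    ab≤0 : d a b ≤ᵣ 0ᵣ
    ab≤0 q 0<q = let (η , 0<η , N , lt) = close q 0<q in N , λ n N≤n → begin
      seq (d a b) n          ≡⟨ ℚ.+-identityʳ (seq (d a b) n) ⟨
      seq (d a b) n ℚ.+ 0ℚ   ≤⟨ ℚ.+-monoʳ-≤ (seq (d a b) n) (ℚ.<⇒≤ 0<η) ⟩
      seq (d a b) n ℚ.+ η    ≤⟨ lt n N≤n ⟩
      q                      ≡⟨ ℚ.+-identityˡ q ⟨
      0ℚ ℚ.+ q               ∎
      where open ℚ.≤-Reasoning

  -- w is a limit of shifts S^m z along integers m converging to the p-adic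
  -- integer whose residue modulo p J is u J.
  LimitOver : (ℤ → Carrier) → (ℕ → ℕ) → (ℤ → Carrier) → Set
  LimitOver z u w = ∀ N q J → 0ℚ ℚ.< q →
    ∃[ m ] (m ≡ + u J ⟨mod p J ⟩ × Near X N (fromℚ q) w (S^[ m ] z))

  -- The shifts are natural numbers, so iterating `shift` reaches them. For the residues of an
  -- expansion, `J ≤ j` controls the shift modulo `p J`.
  LimitAlong : (ℤ → Carrier) → (ℕ → ℕ) → (ℤ → Carrier) → Set
  LimitAlong z n y = ∀ N ε J → 0ᵣ <ᵣ ε → ∃[ j ] (J ≤ j × Near X N ε y (S^[ + n j ] z))

  -- The approximating shifts are congruent to `u J` modulo `p J`, and stage `J` sees only that
  -- residue, so all of them have the value `v` at `i`.
  limitOver-value : ∀ (x : ℕ → Carrier) u {w} → LimitOver (oxtoby fg x) u w →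
                    ∀ J i {v} → stage fg x J (+ u J ℤ.+ i) ≡ just v → w i ≈ v
  limitOver-value x u {w} over J i {v} eq = arbitrarilyClose⇒≈ λ q 0<q →
    let (m , m≡u , near) = over ∣ i ∣ q J 0<q
        i+m≡u+i = subst (λ t → t ≡ + u J ℤ.+ i ⟨mod p J ⟩) (ℤ.+-comm m i) (≡mod-+ m≡u (≡mod-refl i))
    in subst (λ t → d (w i) t <ᵣ fromℚ q)
         (stage-oxtoby x J (i ℤ.+ m) (trans (stage-≡mod x J i+m≡u+i) eq))
         (near i ℕ.≤-refl)

  module _ (em : ExcludedMiddle 0ℓ) where
    open Classical em

    -- Compactness of the odometer: digits are chosen one by one so that infinitely many
    -- approximating shifts stay in the chosen residue class.
    orbitClosure⇒limitOver : ∀ {z w} → InOrbitClosure X z w →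
                             Σ[ H ∈ Expansion ] LimitOver z (value H) w
    orbitClosure⇒limitOver {z} {w} w∈ = H , H-limit
      where
      positive : ∀ M → 0ᵣ <ᵣ fromℚ (unitFraction M)
      positive M = 0<ᵣfromℚ (ℚ.*<* (ℤ.+<+ (s≤s z≤n)))

      n : ℕ → ℤ
      n M = proj₁ (w∈ M (fromℚ (unitFraction M)) (positive M))

      n-near : ∀ M → Near X M (fromℚ (unitFraction M)) w (S^[ n M ] z)
      n-near M = proj₂ (w∈ M (fromℚ (unitFraction M)) (positive M))

      Cluster : ℕ → ℕ → Set
      Cluster j a = ∀ N → ∃[ M ] (N ≤ M × n M ≡ + a ⟨mod p j ⟩)

      refine : ∀ j a → Cluster j a → ∃[ c ] (c < ratio j × Cluster (suc j) (a ℕ.+ c ℕ.* p j))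
      refine j a often = pigeonhole (ratio j) (λ c M → n M ≡ + (a ℕ.+ c ℕ.* p j) ⟨mod p (suc j) ⟩) digits
        where
        digits : ∀ N → ∃[ M ] (N ≤ M × ∃[ c ] (c < ratio j × n M ≡ + (a ℕ.+ c ℕ.* p j) ⟨mod p (suc j) ⟩))
        digits N = let (M , N≤M , n≡a) = often N in M , N≤M , ≡mod-refine j n≡a

      state : ∀ j → ∃ (Cluster j)
      state zero    = 0 , λ N → N , ℕ.≤-refl , by (n N)
        (sym (trans (ℤ.+-identityˡ _) (trans (cong (λ t → n N ℤ.* + t) p₀≡1) (ℤ.*-identityʳ (n N)))))
      state (suc j) = let (a , often) = state j ; (c , _ , often′) = refine j a often in
        a ℕ.+ c ℕ.* p j , often′

      H : Expansion
      H = record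
        { value     = λ j → proj₁ (state j)
        ; digit     = λ j → proj₁ (refine j _ (proj₂ (state j)))
        ; digit<    = λ j → proj₁ (proj₂ (refine j _ (proj₂ (state j))))
        ; value-0   = refl
        ; value-suc = λ _ → refl
        }

      H-limit : LimitOver z (value H) w
      H-limit N q J 0<q =
        let (K , small) = archimedean q 0<q
            -- `N` secures the window, `K` the precision 1/(M+1) ≤ q.
            (M , N⊔K≤M , n≡a) = proj₂ (state J) (N ℕ.⊔ K)
        in n M , n≡a , λ i ∣i∣≤N →
             <ᵣ-≤-trans (d (w i) (z (i ℤ.+ n M))) (small M (ℕ.m⊔n≤o⇒n≤o N K N⊔K≤M))
               (n-near M i (ℕ.≤-trans ∣i∣≤N (ℕ.m⊔n≤o⇒m≤o N K N⊔K≤M)))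

  -- Transport of limits by the isomorphism.

  module _ {z z′ : ℤ → Carrier} (f : Isomorphism X z z′) where
    open Isomorphism f

    orbit : ℕ → OrbitClosure X z
    orbit zero    = basePoint X z
    orbit (suc n) = shift X z (orbit n)

    shift-index : ∀ i n → (i ℤ.+ 1ℤ) ℤ.+ + n ≡ i ℤ.+ + suc n
    shift-index i n = ℤ.+-assoc i 1ℤ (+ n)

    orbit-value : ∀ n i → proj₁ (orbit n) i ≡ z (i ℤ.+ + n)
    orbit-value zero    i = cong z (sym (ℤ.+-identityʳ i))
    orbit-value (suc n) i = trans (orbit-value n (i ℤ.+ 1ℤ)) (cong z (shift-index i n))

    to-orbit : ∀ n i → proj₁ (to (orbit n)) i ≈ proj₁ (to (basePoint X z)) (i ℤ.+ + n)
    to-orbit zero    i = EqC.reflexive (cong (proj₁ (to (basePoint X z))) (sym (ℤ.+-identityʳ i)))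
    to-orbit (suc n) i = EqC.trans (commutes (orbit n) i) (EqC.trans (to-orbit n (i ℤ.+ 1ℤ))
      (EqC.reflexive (cong (proj₁ (to (basePoint X z))) (shift-index i n))))

    to-injective : ∀ u v → _≋_ X (proj₁ (to u)) (proj₁ (to v)) → _≋_ X (proj₁ u) (proj₁ v)
    to-injective u v eq i = EqC.trans
      (EqC.sym (Inverse.inverseʳ inverse {u} {to v} (λ j → EqC.sym (eq j)) i))
      (Inverse.inverseʳ inverse {v} {to v} (λ j → EqC.refl) i)

    -- Since S^g z is near `y`, continuity and equivariance put S^g of the image of z near `to y`.
    -- That image is itself near S^m z′, so the residues of g and m add.
    to-limitOver : ∀ G u y → LimitAlong z (value G) (proj₁ y) →
                   LimitOver z′ u (proj₁ (to (basePoint X z))) →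
                   LimitOver z′ (λ j → value G j ℕ.+ u j) (proj₁ (to y))
    to-limitOver G u y along over N q J 0<q =
      let (M , δ , 0<δ , cont) = to-continuous y N (fromℚ (half q)) (0<ᵣfromℚ (0<half 0<q))
          (j , J≤j , near) = along M δ J 0<δ
          g = value G j
          -- The window is enlarged by `g` because this estimate is read at `i + g`.
          (m , m≡u , near′) = over (N ℕ.+ g) (half q) J (0<half 0<q)
          w = proj₁ (to (basePoint X z))
          close = cont (orbit g) λ i ∣i∣≤M →
            subst (λ t → d (proj₁ y i) t <ᵣ δ) (sym (orbit-value g i)) (near i ∣i∣≤M)
      in + g ℤ.+ m , ≡mod-+ (value-coherent G J≤j) m≡u , λ i ∣i∣≤N →
           d-triangle-< (proj₁ (to y) i) (w (i ℤ.+ + g)) (z′ (i ℤ.+ (+ g ℤ.+ m))) q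
             (d-respʳ-< (proj₁ (to y) i) (fromℚ (half q)) (to-orbit g i) (close i ∣i∣≤N))
             (subst (λ t → d (w (i ℤ.+ + g)) (z′ t) <ᵣ fromℚ (half q)) (ℤ.+-assoc i (+ g) m)
               (near′ (i ℤ.+ + g) (ℕ.≤-trans (ℤ.∣i+j∣≤∣i∣+∣j∣ i (+ g)) (ℕ.+-monoˡ-≤ g ∣i∣≤N))))

  -- Points over G with a prescribed value in the hole.

  module Fill (x : ℕ → Carrier) (G : Expansion) (nonextreme : Nonextreme G) where

    -- The positions of G + ℤ that are never defined form a single hole, which is
    -- filled with the value a.
    fill : Carrier → ℤ → Carrier
    fill a i = fromMaybe a (stage fg x (suc ∣ i ∣) (+ value G (suc ∣ i ∣) ℤ.+ i))

    shifted-back : ∀ i k j → k < j → ¬ Selected fg k ((+ value G j ℤ.+ i) ℤ.+ ℤ.- i)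
    shifted-back i k j k<j sel = unselected G nonextreme k
      (selected-≡mod k (≡mod-sym (value-coherent G k<j)) (subst (Selected fg k) (cancel (+ value G j) i) sel))
      where
      cancel : ∀ g i → (g ℤ.+ i) ℤ.+ ℤ.- i ≡ g
      cancel = solve-∀

    -- Shifting back by `i` would make the position of G itself selected at level `l` or the one
    -- below, against its nonextreme digits.
    shifted-unselected : ∀ i l j → ∣ i ∣ < l → l < j → ¬ Selected fg l (+ value G j ℤ.+ i)
    shifted-unselected i (suc l) j (s≤s ∣i∣≤l) l<j sel
      with selected-shift l (+ value G j ℤ.+ i) (ℤ.- i)
             (subst (_≤ p l) (sym (ℤ.∣-i∣≡∣i∣ i)) (ℕ.≤-trans ∣i∣≤l (ℕ.<⇒≤ (i<pᵢ l)))) sel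
    ... | inj₁ sel′ = contradiction sel′ (shifted-back i (suc l) j l<j)
    ... | inj₂ sel′ = contradiction sel′ (shifted-back i l j (ℕ.<⇒≤ l<j))

    -- Position `i` can be filled only at levels up to `∣ i ∣`, so its stage is frozen from
    -- `suc ∣ i ∣` on, the stage that `fill` reads.
    stage-coherent : ∀ i j → ∣ i ∣ < j →
      stage fg x j (+ value G j ℤ.+ i) ≡ stage fg x (suc ∣ i ∣) (+ value G (suc ∣ i ∣) ℤ.+ i)
    stage-coherent i j ∣i∣<j = trans
      (stage-stationary x (+ value G j ℤ.+ i) ∣i∣<j (λ l i<l l<j → shifted-unselected i l j i<l l<j))
      (stage-≡mod x (suc ∣ i ∣) (≡mod-+ (value-coherent G ∣i∣<j) (≡mod-refl i)))

    -- Truncating G below level `j` puts the extreme digit 0 there, and the margin left by the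
    -- preceding digit keeps the shift by `i` inside the window. The visible part of the hole thus
    -- receives `x j`.
    hole-selected : ∀ i j → ∣ i ∣ < j → Selected fg j (+ value G j ℤ.+ i)
    hole-selected i (suc j) (s≤s ∣i∣≤j) = near⇒selected (suc j) _
      ( 0ℤ
      , linear-≤ _ _ (ℤ.+-mono-≤ (ℤ.+≤+ (z≤n {g})) (ℤ.≤-trans (ℤ.neg-mono-≤ (ℤ.+≤+ (ℕ.≤-trans ∣i∣≤p (p-mono (ℕ.n≤1+n j))))) (-∣i∣≤i i)))
          (eq₁ (+ g) i (+ p (suc j)) (+ p (suc (suc j))))
      , subst (+ g ℤ.+ i ℤ.<_) (sym (ℤ.+-identityˡ (+ p (suc j))))
          (ℤ.≤-<-trans (ℤ.+-monoʳ-≤ (+ g) (ℤ.≤-trans (i≤∣i∣ i) (ℤ.+≤+ ∣i∣≤p))) (ℤ.+<+ bound)))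
      where
      g = value G (suc j)
      ∣i∣≤p : ∣ i ∣ ≤ p j
      ∣i∣≤p = ℕ.≤-trans ∣i∣≤j (ℕ.<⇒≤ (i<pᵢ j))
      bound : g ℕ.+ p j < p (suc j)
      bound = subst (λ t → t ℕ.+ p j < p (suc j)) (sym (value-suc G j))
        (nonextreme-bound j (value G j) (digit G j) (value< G j) (proj₂ (nonextreme j)))
      eq₁ : ∀ g i m n → ((g ℤ.+ i) ℤ.+ m) ℤ.- 0ℤ ℤ.* n ≡ (g ℤ.+ i) ℤ.- (0ℤ ℤ.+ ℤ.- m)
      eq₁ = solve-∀

    -- Under the shifts by `value G (φ k)`, coordinates outside the hole are eventually constant,
    -- while the hole carries `x (φ k)`, which tends to `a`.
    fill-limit : ∀ {a} → ωLimit X x a → LimitAlong (oxtoby fg x) (value G) (fill a)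
    fill-limit {a} (φ , φ-mono , conv) N ε J 0<ε = j , J≤j , near
      where
      n≤φn : ∀ n → n ≤ φ n
      n≤φn zero    = z≤n
      n≤φn (suc n) = ℕ.≤-<-trans (n≤φn n) (φ-mono (ℕ.n<1+n n))
      K = proj₁ (conv ε 0<ε)
      -- `K` gives closeness to `a`; through `n ≤ φ n` the rest gives `J ≤ j` and `N < j`.
      k = K ℕ.⊔ (J ℕ.⊔ suc N)
      j = φ k
      J⊔N<j : J ℕ.⊔ suc N ≤ j
      J⊔N<j = ℕ.≤-trans (ℕ.m≤n⊔m K _) (n≤φn k)
      J≤j = ℕ.m⊔n≤o⇒m≤o J (suc N) J⊔N<j
      near : Near X N ε (fill a) (S^[ + value G j ] (oxtoby fg x))
      near i ∣i∣≤N with stage fg x (suc ∣ i ∣) (+ value G (suc ∣ i ∣) ℤ.+ i)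
                      | stage-coherent i j (ℕ.≤-trans (s≤s ∣i∣≤N) (ℕ.m⊔n≤o⇒n≤o J (suc N) J⊔N<j))
      ... | just v  | eq = d-refl ε 0<ε (sym (trans
              (cong (oxtoby fg x) (ℤ.+-comm i (+ value G j))) (stage-oxtoby x j _ eq)))
      ... | nothing | eq = subst (λ t → d a t <ᵣ ε)
              (sym (trans (cong (oxtoby fg x) (ℤ.+-comm i (+ value G j)))
                (stage-oxtoby x (suc j) _ (stage-suc-selected x j _ eq
                  (hole-selected i j (ℕ.≤-trans (s≤s ∣i∣≤N) (ℕ.m⊔n≤o⇒n≤o J (suc N) J⊔N<j)))))))
              (d-comm-< (x j) a ε (proj₂ (conv ε 0<ε) k (ℕ.m≤m⊔n K _)))

    fill-orbitClosure : ∀ {a} → ωLimit X x a → OrbitClosure X (oxtoby fg x)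
    fill-orbitClosure {a} lim = fill a , λ N ε 0<ε →
      let (j , _ , near) = fill-limit lim N ε 0 0<ε in + value G j , near

    -- Position 0 is in the hole because the lowest digit of G is nonextreme; different values of
    -- `a` therefore give different points.
    fill-0 : ∀ a → fill a 0ℤ ≡ a
    fill-0 a = cong (fromMaybe a) (stage-suc-unselected x 0 (+ value G 1 ℤ.+ 0ℤ)
      (λ sel → unselected G nonextreme 0 (subst (Selected fg 0) (ℤ.+-identityʳ (+ value G 1)) sel)))

-- Integrality of the odometer point under f(z).

theorem5p1 : ∀ {ℓ} → ExcludedMiddle ℓ →
    (X : MetricSpace ℓ) → Compact X →
    (x x′ : ℕ → MetricSpace.Carrier X) →
    (p : ℕ → ℕ) (fg : FastGrowing p) →
    AtLeastTwoPoints X (ωLimit X x) →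
    AtLeastTwoPoints X (ωLimit X x′) →
    (f : Isomorphism X (oxtoby fg x) (oxtoby fg x′)) →
    ∃[ m ] _≋_ X (proj₁ (Isomorphism.to f (basePoint X (oxtoby fg x)))) (S^[ m ] (oxtoby fg x′))
theorem5p1 {ℓ} em X _ x x′ p fg (a , b , a∈L , b∈L , a≉b) _ f =
  conclude (eventually-or-often (λ j → Selected fg j (+ E (suc j))))
  where
  em₀ : ExcludedMiddle 0ℓ
  em₀ {P} = map′ unlift lift (em {Lift ℓ P})

  open MetricSpace X
  open Isomorphism f
  open Classical em₀
  open Levels fg
  open Dynamics X fg

  fz = to (basePoint X (oxtoby fg x))
  over = orbitClosure⇒limitOver em₀ {oxtoby fg x′} (proj₂ fz)
  H = proj₁ over
  open Complement H
  open Fill x G G-nonextreme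

  conclude : (∃[ J ] (∀ j → J ≤ j → ¬ Selected fg j (+ E (suc j)))) ⊎
             (∀ J → ∃[ j ] (J ≤ j × Selected fg j (+ E (suc j)))) →
             ∃[ m ] _≋_ X (proj₁ fz) (S^[ m ] (oxtoby fg x′))
  conclude (inj₁ (J , ¬sel)) = let (m , H≡m) = integer J ¬sel in m , λ i →
    -- This level is past `J`, where H agrees with `m`, and past a stage that defines z′ at `i + m`.
    let j = J ℕ.⊔ suc ∣ i ℤ.+ m ∣
        (v , eq) = stage-defined x′ ∣ i ℤ.+ m ∣ (i ℤ.+ m) (selectedNearZero fg (i ℤ.+ m))
        eq′ = stage-mono x′ (i ℤ.+ m) (ℕ.m≤n⊔m J (suc ∣ i ℤ.+ m ∣)) eq
        H+i≡i+m = subst (λ t → + value H j ℤ.+ i ≡ t ⟨mod p j ⟩) (ℤ.+-comm m i)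
                    (≡mod-+ (H≡m j (ℕ.m≤m⊔n J _)) (≡mod-refl i))
    in EqC.trans (limitOver-value x′ (value H) (proj₂ over) j i (trans (stage-≡mod x′ j H+i≡i+m) eq′))
         (EqC.reflexive (sym (stage-oxtoby x′ j (i ℤ.+ m) eq′)))
  conclude (inj₂ often) = contradiction a≈b a≉b
    where
    y : ∀ {c} → ωLimit X x c → OrbitClosure X (oxtoby fg x)
    y = fill-orbitClosure

    y-over : ∀ {c} (c∈L : ωLimit X x c) → LimitOver (oxtoby fg x′) E (proj₁ (to (y c∈L)))
    y-over c∈L = to-limitOver f G (value H) (y c∈L) (fill-limit c∈L) (proj₂ over)

    -- Both images lie over G + H, where infinitely many extreme digits determine every coordinate.
    images-agree : _≋_ X (proj₁ (to (y a∈L))) (proj₁ (to (y b∈L)))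
    images-agree i = let (J , v , eq) = eventually-defined x′ often i in
      EqC.trans (limitOver-value x′ E (y-over a∈L) J i eq)
        (EqC.sym (limitOver-value x′ E (y-over b∈L) J i eq))

    a≈b : a ≈ b
    a≈b = EqC.trans (EqC.reflexive (sym (fill-0 a)))
      (EqC.trans (to-injective f (y a∈L) (y b∈L) images-agree 0ℤ) (EqC.reflexive (fill-0 b)))
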